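{- For integers $p\ge1$ and $m\ge0$, \[ \sum_{n=1}^\infty\frac{H_n\,s(n,p)}{n!\,n^{m+1}}=(p+1)\,\zeta(p+2,\{1\}_m)+\sum_{i=1}^m\zeta(p+1,\{1\}_{i-1},2,\{1\}_{m-i}). \]
   Context: $H_n=\sum_{j=1}^n 1/j$. $s(n,k)$ is the unsigned Stirling number of the first kind ($s(n,k)=s(n-1,k-1)+(n-1)s(n-1,k)$, $s(0,0)=1$, $s(n,0)=s(0,k)=0$ for $n,k\ge1$). For positive integers $s_1\ge2,s_2,\dots,s_r$, the multiple zeta value is $\zeta(s_1,\dots,s_r)=\sum_{n_1>n_2>\cdots>n_r\ge1}n_1^{ -s_1}\cdots n_r^{ -s_r}$. $\{1\}_j$ denotes $j$ consecutive arguments equal to $1$ (none if $j=0$). -}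

module Defs where

open import Data.Nat using (ℕ; zero; suc; _*_; _^_; _∸_; _≥_; _!)

open import Data.Integer using (+_)
open import Data.Rational using (ℚ; 0ℚ; 1ℚ; _/_; _<_; ∣_∣; _-_)
  renaming (_+_ to _+ℚ_; _*_ to _*ℚ_)
open import Data.List using (List; []; _∷_; replicate; _++_)
open import Data.Product using (Σ; _×_)

-- unsigned Stirling numbers of the first kind
stirling : ℕ → ℕ → ℕ
stirling zero    zero    = 1
stirling zero    (suc k) = 0
stirling (suc n) zero    = 0
stirling (suc n) (suc k) = stirling n k + n * stirling n (suc k)
  where open Data.Nat using (_+_)

ℕ→ℚ : ℕ → ℚ
ℕ→ℚ n = + n / 1

-- reciprocal of a natural number (convention: inv 0 = 0; only used at d ≥ 1)
inv : ℕ → ℚ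
inv zero    = 0ℚ
inv (suc k) = + 1 / suc k

sumTo : ℕ → (ℕ → ℚ) → ℚ
sumTo zero    f = 0ℚ
sumTo (suc M) f = sumTo M f +ℚ f (suc M)

H : ℕ → ℚ
H n = sumTo n inv

-- truncated multiple zeta value:
-- mzvT (s₁ ∷ … ∷ s_r) N = Σ_{N ≥ n₁ > n₂ > ⋯ > n_r ≥ 1} n₁^{-s₁} ⋯ n_r^{-s_r}
mzvT : List ℕ → ℕ → ℚ
mzvT []       N = 1ℚ
mzvT (s ∷ ss) N = sumTo N (λ n → inv (n ^ s) *ℚ mzvT ss (n ∸ 1))

ones : ℕ → List ℕ
ones j = replicate j 1

lhsPartial : ℕ → ℕ → ℕ → ℚ
lhsPartial p m M =
  sumTo M (λ n → H n *ℚ (ℕ→ℚ (stirling n p) *ℚ inv ((n !) * n ^ (suc m))))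

rhsPartial : ℕ → ℕ → ℕ → ℚ
rhsPartial p m M =
  ℕ→ℚ (suc p) *ℚ mzvT (suc (suc p) ∷ ones m) M
  +ℚ sumTo m (λ i → mzvT (suc p ∷ (ones (i ∸ 1) ++ (2 ∷ ones (m ∸ i)))) M)

Cauchy : (ℕ → ℚ) → Set
Cauchy a = (ε : ℚ) → 0ℚ < ε →
  Σ ℕ λ N → (M K : ℕ) → M ≥ N → K ≥ N → ∣ a M - a K ∣ < ε

SameLimit : (ℕ → ℚ) → (ℕ → ℚ) → Set
SameLimit a b = (ε : ℚ) → 0ℚ < ε →
  Σ ℕ λ N → (M : ℕ) → M ≥ N → ∣ a M - b M ∣ < ε

-- "Σ_n a_n-type limit of a equals limit of b, both existing" as real numbers
SeriesEq : (ℕ → ℚ) → (ℕ → ℚ) → Set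
SeriesEq a b = Cauchy a × Cauchy b × SameLimit a b

{-# OPTIONS --safe #-}

-- Shift the second index of the connected sums of Seki and Yamamoto by a parameter x, i.e. use the kernel
-- K(n,m) = n! Γ(m+1+x) / Γ(n+m+1+x).  It satisfies
--   Σ_{b>m} K(n,b)/(b+x) = K(n,m)/n   and   Σ_{a>n} K(a,m)/a = K(n,m)/(m+x),
-- and moving all factors from one index to the other turns these into the duality
--   Σ_n s(n,p)/(n! n^{m+1}) K(n,0) = Σ_{n₁>⋯>n_{m+1}≥1} (n₁+x)^{-p-1} (n₂+x)^{-1} ⋯ (n_{m+1}+x)^{-1}.
-- The theorem is minus the derivative of this identity at x = 0, because −∂K(n,0)/∂x = H_n there.
-- The derivative is taken algebraically, over dual numbers.  For sums truncated at M every move holds up to an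
-- explicit boundary term of size at most (2 + 2 H_M)^k / (M+1), which tends to 0.

module Submission where

open import Defs
open import Algebra.Bundles using (CommutativeRing; CommutativeSemiring)
open import Algebra.Structures.Biased using (isCommutativeSemiringˡ)
import Algebra.Solver.Ring.NaturalCoefficients.Default as SemiringSolver
open import Data.Integer using (+_)
import Data.Integer as ℤ
import Data.Integer.Properties as ℤ
open import Data.List using (List; _∷_; _++_)
open import Data.Nat as ℕ using (ℕ; zero; suc; _!; _≥_)
import Data.Nat.Properties as ℕ
open import Data.Product using (Σ; _×_; _,_; proj₁; proj₂)
open import Data.Rational hiding (_≥_)
open import Data.Rational.Properties
open import Data.Rational.Solver using (module +-*-Solver)
import Data.Rational.Unnormalised as ℚᵘ
import Data.Rational.Unnormalised.Properties as ℚᵘ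
open import Data.Sum using (inj₁; inj₂)
open import Level using (0ℓ)
open import Relation.Binary.PropositionalEquality
open import Algebra.Properties.Semiring.Exp (CommutativeRing.semiring +-*-commutativeRing) using (_^_; ^-homo-*)

-- Differentiating an identity between infinite sums would require exchanging a limit with d/dx.
-- Over dual numbers each truncated move is an exact finite identity, so value and derivative move
-- together, and one bound on the sum of both components controls the error in each. The truncation
-- is to a square 0 ≤ n, m ≤ M, so that the same finite double sum can be read from either index.
-- The estimates stay inside ℚ, without logarithms or roots. That powers of H_M lose against M is
-- shown by comparison with the product `g`: its increments 1/(3j) are small enough to keep `g`
-- below a square root, and a suitable multiple of `g` still outgrows any fixed power of H.

-- Order and powers in ℚ.

0≤+ : ∀ {a b} → 0ℚ ≤ a → 0ℚ ≤ b → 0ℚ ≤ a + b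
0≤+ {a} {b} p q = subst (_≤ a + b) (+-identityˡ 0ℚ) (+-mono-≤ p q)

*-mono-≤ : ∀ {a b c d} → 0ℚ ≤ a → a ≤ b → 0ℚ ≤ c → c ≤ d → a * c ≤ b * d
*-mono-≤ {a} {b} {c} {d} 0≤a a≤b 0≤c c≤d = ≤-trans
  (*-monoʳ-≤-nonNeg c {{nonNegative 0≤c}} a≤b)
  (*-monoˡ-≤-nonNeg b {{nonNegative (≤-trans 0≤a a≤b)}} c≤d)

*-monoˡ : ∀ {a c d} → 0ℚ ≤ a → c ≤ d → a * c ≤ a * d
*-monoˡ {a} 0≤a = *-monoˡ-≤-nonNeg a {{nonNegative 0≤a}}

*-monoʳ : ∀ {a b c} → 0ℚ ≤ c → a ≤ b → a * c ≤ b * c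
*-monoʳ {c = c} 0≤c = *-monoʳ-≤-nonNeg c {{nonNegative 0≤c}}

0≤* : ∀ {a b} → 0ℚ ≤ a → 0ℚ ≤ b → 0ℚ ≤ a * b
0≤* {a} {b} p q = subst (_≤ a * b) (*-zeroʳ a) (*-monoˡ p q)

p≤p+q : ∀ {p q} → 0ℚ ≤ q → p ≤ p + q
p≤p+q {p} {q} 0≤q = subst (_≤ p + q) (+-identityʳ p) (+-monoʳ-≤ p 0≤q)

p≤q+p : ∀ {p q} → 0ℚ ≤ q → p ≤ q + p
p≤q+p {p} {q} 0≤q = subst (_≤ q + p) (+-identityˡ p) (+-monoˡ-≤ p 0≤q)

0≤1 : 0ℚ ≤ 1ℚ
0≤1 = nonNegative⁻¹ 1ℚ

^-nonNeg : ∀ {a} n → 0ℚ ≤ a → 0ℚ ≤ a ^ n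
^-nonNeg zero    p = 0≤1
^-nonNeg (suc n) p = 0≤* p (^-nonNeg n p)

^-mono : ∀ {a b} n → 0ℚ ≤ a → a ≤ b → a ^ n ≤ b ^ n
^-mono zero    p q = ≤-refl
^-mono (suc n) p q = *-mono-≤ p q (^-nonNeg n p) (^-mono n p q)

-- Naturals and reciprocals as rationals.

-- `_/_` normalises by a gcd, which is stuck on variables; identities between fractions are
-- therefore proved for unnormalised rationals, where they are integer identities, and carried over.
fromℚᵘ-homo-* : ∀ p q → fromℚᵘ (p ℚᵘ.* q) ≡ fromℚᵘ p * fromℚᵘ q
fromℚᵘ-homo-* p q = toℚᵘ-injective (ℚᵘ.≃-trans (toℚᵘ-fromℚᵘ (p ℚᵘ.* q))
  (ℚᵘ.≃-trans (ℚᵘ.*-cong (ℚᵘ.≃-sym (toℚᵘ-fromℚᵘ p)) (ℚᵘ.≃-sym (toℚᵘ-fromℚᵘ q)))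
    (ℚᵘ.≃-sym (toℚᵘ-homo-* (fromℚᵘ p) (fromℚᵘ q)))))

fromℚᵘ-homo-+ : ∀ p q → fromℚᵘ (p ℚᵘ.+ q) ≡ fromℚᵘ p + fromℚᵘ q
fromℚᵘ-homo-+ p q = toℚᵘ-injective (ℚᵘ.≃-trans (toℚᵘ-fromℚᵘ (p ℚᵘ.+ q))
  (ℚᵘ.≃-trans (ℚᵘ.+-cong (ℚᵘ.≃-sym (toℚᵘ-fromℚᵘ p)) (ℚᵘ.≃-sym (toℚᵘ-fromℚᵘ q)))
    (ℚᵘ.≃-sym (toℚᵘ-homo-+ (fromℚᵘ p) (fromℚᵘ q)))))

ℕ→ℚ-homo-* : ∀ m n → ℕ→ℚ (m ℕ.* n) ≡ ℕ→ℚ m * ℕ→ℚ n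
ℕ→ℚ-homo-* m n = trans (cong (_/ 1) (ℤ.pos-* m n)) (fromℚᵘ-homo-* (+ m ℚᵘ./ 1) (+ n ℚᵘ./ 1))

ℕ→ℚ-homo-+ : ∀ m n → ℕ→ℚ (m ℕ.+ n) ≡ ℕ→ℚ m + ℕ→ℚ n
ℕ→ℚ-homo-+ m n = trans
  (cong (_/ 1) (trans (ℤ.pos-+ m n) (sym (cong₂ ℤ._+_ (ℤ.*-identityʳ (+ m)) (ℤ.*-identityʳ (+ n))))))
  (fromℚᵘ-homo-+ (+ m ℚᵘ./ 1) (+ n ℚᵘ./ 1))

0≤ℕ→ℚ : ∀ n → 0ℚ ≤ ℕ→ℚ n
0≤ℕ→ℚ n = nonNegative⁻¹ (ℕ→ℚ n) {{normalize-nonNeg n 1}}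

inv-inverse : ∀ n → ℕ→ℚ (suc n) * inv (suc n) ≡ 1ℚ
inv-inverse n = trans (sym (fromℚᵘ-homo-* (+ suc n ℚᵘ./ 1) (+ 1 ℚᵘ./ suc n)))
  (fromℚᵘ-cong {(+ suc n ℚᵘ./ 1) ℚᵘ.* (+ 1 ℚᵘ./ suc n)} {ℚᵘ.1ℚᵘ}
    (ℚᵘ.*≡* (trans (ℤ.*-identityʳ _) (trans (ℤ.*-identityʳ _)
      (sym (trans (ℤ.*-identityˡ _) (cong (λ k → + suc k) (ℕ.+-identityʳ n))))))))

0≤inv : ∀ n → 0ℚ ≤ inv n
0≤inv zero    = ≤-refl
0≤inv (suc n) = nonNegative⁻¹ (inv (suc n)) {{normalize-nonNeg 1 (suc n)}}

inv-unique : ∀ n {q} → ℕ→ℚ (suc n) * q ≡ 1ℚ → q ≡ inv (suc n)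
inv-unique n {q} eq = begin
  q                              ≡⟨ *-identityʳ q ⟨
  q * 1ℚ                         ≡⟨ cong (q *_) (inv-inverse n) ⟨
  q * (ℕ→ℚ (suc n) * inv (suc n)) ≡⟨ solve 3 (λ q n i → q :* (n :* i) := (n :* q) :* i) refl q (ℕ→ℚ (suc n)) (inv (suc n)) ⟩
  (ℕ→ℚ (suc n) * q) * inv (suc n) ≡⟨ cong (_* inv (suc n)) eq ⟩
  1ℚ * inv (suc n)               ≡⟨ *-identityˡ _ ⟩
  inv (suc n) ∎
  where open ≡-Reasoning
        open +-*-Solver

-- The convention `inv 0 = 0` makes reciprocals multiplicative at 0 as well, so the formulas for
-- powers of n below hold for every n.
inv-homo-* : ∀ m n → inv (m ℕ.* n) ≡ inv m * inv n
inv-homo-* zero    n       = sym (*-zeroˡ (inv n))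
inv-homo-* (suc m) zero    = trans (cong inv (ℕ.*-zeroʳ m)) (sym (*-zeroʳ (inv (suc m))))
inv-homo-* (suc m) (suc n) = sym (inv-unique (n ℕ.+ m ℕ.* suc n) (begin
  ℕ→ℚ (suc m ℕ.* suc n) * (inv (suc m) * inv (suc n))           ≡⟨ cong (_* (inv (suc m) * inv (suc n))) (ℕ→ℚ-homo-* (suc m) (suc n)) ⟩
  (ℕ→ℚ (suc m) * ℕ→ℚ (suc n)) * (inv (suc m) * inv (suc n))     ≡⟨ solve 4 (λ a b c d → (a :* b) :* (c :* d) := (a :* c) :* (b :* d)) refl (ℕ→ℚ (suc m)) (ℕ→ℚ (suc n)) (inv (suc m)) (inv (suc n)) ⟩
  (ℕ→ℚ (suc m) * inv (suc m)) * (ℕ→ℚ (suc n) * inv (suc n))     ≡⟨ cong₂ _*_ (inv-inverse m) (inv-inverse n) ⟩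
  1ℚ * 1ℚ                                                       ≡⟨ *-identityˡ 1ℚ ⟩
  1ℚ ∎))
  where open ≡-Reasoning
        open +-*-Solver

ℕ→ℚ-mono-≤ : ∀ {m n} → m ℕ.≤ n → ℕ→ℚ m ≤ ℕ→ℚ n
ℕ→ℚ-mono-≤ {m} {n} m≤n = subst (ℕ→ℚ m ≤_)
  (trans (sym (ℕ→ℚ-homo-+ m (n ℕ.∸ m))) (cong ℕ→ℚ (ℕ.m+[n∸m]≡n m≤n)))
  (p≤p+q (0≤ℕ→ℚ (n ℕ.∸ m)))

inv-anti : ∀ {m n} → m ℕ.≤ n → inv (suc n) ≤ inv (suc m)
inv-anti {m} {n} m≤n = begin
  inv (suc n)                                ≡⟨ *-identityˡ _ ⟨
  1ℚ * inv (suc n)                           ≡⟨ cong (_* inv (suc n)) (inv-inverse m) ⟨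
  ℕ→ℚ (suc m) * inv (suc m) * inv (suc n)    ≤⟨ *-monoʳ (0≤inv (suc n)) (*-monoʳ (0≤inv (suc m)) (ℕ→ℚ-mono-≤ (ℕ.s≤s m≤n))) ⟩
  ℕ→ℚ (suc n) * inv (suc m) * inv (suc n)    ≡⟨ solve 3 (λ n x y → n :* x :* y := (n :* y) :* x) refl (ℕ→ℚ (suc n)) (inv (suc m)) (inv (suc n)) ⟩
  (ℕ→ℚ (suc n) * inv (suc n)) * inv (suc m)  ≡⟨ cong (_* inv (suc m)) (inv-inverse n) ⟩
  1ℚ * inv (suc m)                           ≡⟨ *-identityˡ _ ⟩
  inv (suc m) ∎
  where open ≤-Reasoning
        open +-*-Solver

inv≤1 : ∀ n → inv n ≤ 1ℚ
inv≤1 zero    = 0≤1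
inv≤1 (suc n) = inv-anti {0} {n} ℕ.z≤n

inv-suc : ∀ n → inv (suc n) ≡ inv (suc (suc n)) + inv (suc n) * inv (suc (suc n))
inv-suc n = begin
  x                     ≡⟨ *-identityʳ x ⟨
  x * 1ℚ                ≡⟨ cong (x *_) (inv-inverse (suc n)) ⟨
  x * (ℕ→ℚ (2 ℕ.+ n) * z) ≡⟨ cong (λ q → x * (q * z)) (ℕ→ℚ-homo-+ 1 (suc n)) ⟩
  x * ((1ℚ + ℕ→ℚ (suc n)) * z) ≡⟨ solve 3 (λ x z k → x :* ((con 1ℚ :+ k) :* z) := (k :* x) :* z :+ x :* z) refl x z (ℕ→ℚ (suc n)) ⟩
  (ℕ→ℚ (suc n) * x) * z + x * z ≡⟨ cong (λ q → q * z + x * z) (inv-inverse n) ⟩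
  1ℚ * z + x * z        ≡⟨ cong (_+ x * z) (*-identityˡ z) ⟩
  z + x * z ∎
  where open ≡-Reasoning
        open +-*-Solver
        x = inv (suc n)
        z = inv (suc (suc n))

-- Null sequences.

archimedean : ∀ ε → 0ℚ < ε → Σ ℕ λ N → inv (suc N) < ε
archimedean ε 0<ε = go ε {{positive 0<ε}}
  where
  go : ∀ ε → {{Positive ε}} → Σ ℕ λ N → inv (suc N) < ε
  -- For ε = (a+1)/(d+1) already 1/(d+2) < 1/(d+1) ≤ ε, whatever a is.
  go (mkℚ (+ suc a) d _) = suc d , toℚᵘ-cancel-<
    (ℚᵘ.<-respˡ-≃ (ℚᵘ.≃-sym (toℚᵘ-fromℚᵘ (+ 1 ℚᵘ./ (2 ℕ.+ d))))
      (ℚᵘ.*<* (ℤ.+<+ (ℕ.≤-trans (ℕ.s≤s (ℕ.s≤s (ℕ.≤-reflexive (ℕ.+-identityʳ d)))) (ℕ.m≤m+n (2 ℕ.+ d) _)))))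

-- One-sided, being applied to nonnegative sequences. `SameLimit a b` unfolds to
-- `Null (λ M → ∣ a M - b M ∣)`, so the closure properties below serve for it too.
Null : (ℕ → ℚ) → Set
Null f = ∀ ε → 0ℚ < ε → Σ ℕ λ N → ∀ n → n ℕ.≥ N → f n < ε

Null-≤ : ∀ {f g} → (∀ n → f n ≤ g n) → Null g → Null f
Null-≤ f≤g g→0 ε 0<ε = let N , small = g→0 ε 0<ε in N , λ n n≥N → ≤-<-trans (f≤g n) (small n n≥N)

half : ℚ → ℚ
half ε = ½ * ε

0<half : ∀ {ε} → 0ℚ < ε → 0ℚ < half ε
0<half {ε} 0<ε = subst (_< half ε) (*-zeroʳ ½) (*-monoʳ-<-pos ½ 0<ε)

half+half : ∀ ε → half ε + half ε ≡ ε
half+half = solve 1 (λ ε → con ½ :* ε :+ con ½ :* ε := ε) refl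
  where open +-*-Solver

Null-+ : ∀ {f g} → Null f → Null g → Null (λ n → f n + g n)
Null-+ f→0 g→0 ε 0<ε =
  let N , f< = f→0 (half ε) (0<half 0<ε)
      M , g< = g→0 (half ε) (0<half 0<ε)
  in N ℕ.+ M , λ n n≥ → subst (_ <_) (half+half ε)
       (+-mono-< (f< n (ℕ.≤-trans (ℕ.m≤m+n N M) n≥)) (g< n (ℕ.≤-trans (ℕ.m≤n+m M N) n≥)))

Null-* : ∀ {f} c → 0ℚ ≤ c → Null f → Null (λ n → c * f n)
Null-* {f} c 0≤c f→0 ε 0<ε = proj₁ (f→0 δ 0<δ) , λ n n≥ → begin-strict
  c * f n      ≤⟨ *-monoˡ 0≤c (<⇒≤ (proj₂ (f→0 δ 0<δ) n n≥)) ⟩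
  c * δ        <⟨ subst (_< 1ℚ * δ + c * δ) (+-identityˡ (c * δ)) (+-monoˡ-< (c * δ) (subst (0ℚ <_) (sym (*-identityˡ δ)) 0<δ)) ⟩
  1ℚ * δ + c * δ ≡⟨ solve 3 (λ c r ε → con 1ℚ :* (r :* ε) :+ c :* (r :* ε) := (con 1ℚ :+ c) :* r :* ε) refl c r ε ⟩
  (1ℚ + c) * r * ε ≡⟨ cong (_* ε) (*-inverseʳ (1ℚ + c)) ⟩
  1ℚ * ε       ≡⟨ *-identityˡ ε ⟩
  ε ∎
  where
  open ≤-Reasoning
  open +-*-Solver
  instance
    pos-1+c : Positive (1ℚ + c)
    pos-1+c = pos+nonNeg⇒pos 1ℚ c {{nonNegative 0≤c}}
    nonZero-1+c : NonZero (1ℚ + c)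
    nonZero-1+c = pos⇒nonZero (1ℚ + c)
  -- Dividing by 1 + c instead of c covers c = 0 and makes the final inequality strict.
  r = 1/ (1ℚ + c)
  δ = r * ε
  0<δ : 0ℚ < δ
  0<δ = subst (_< δ) (*-zeroʳ r) (*-monoʳ-<-pos r {{1/pos⇒pos (1ℚ + c)}} 0<ε)

-- A rational substitute for a small power of n.

-- g n = ∏_{j ≤ n} (1 + 1/(3j)) is a rational stand-in for the cube root of n.
g : ℕ → ℚ
g zero    = 1ℚ
g (suc n) = g n * (1ℚ + (+ 1 / 3) * inv (suc n))

0≤g : ∀ n → 0ℚ ≤ g n
0≤g zero    = 0≤1
0≤g (suc n) = 0≤* (0≤g n) (0≤+ 0≤1 (0≤* (nonNegative⁻¹ (+ 1 / 3)) (0≤inv (suc n))))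

g-suc-≤ : ∀ n → g (suc n) ≤ ℕ→ℚ 2 * g n
g-suc-≤ n = begin
  g n * (1ℚ + (+ 1 / 3) * inv (suc n)) ≤⟨ *-monoˡ (0≤g n) (+-monoʳ-≤ 1ℚ (*-mono-≤ {+ 1 / 3} {1ℚ} {inv (suc n)} {1ℚ} (nonNegative⁻¹ (+ 1 / 3)) (*≤* (ℤ.+≤+ (ℕ.s≤s ℕ.z≤n))) (0≤inv (suc n)) (inv≤1 (suc n)))) ⟩
  g n * ℕ→ℚ 2  ≡⟨ *-comm (g n) (ℕ→ℚ 2) ⟩
  ℕ→ℚ 2 * g n ∎
  where open ≤-Reasoning

-- For 0 ≤ x ≤ 1, (1 + x/3)² = 1 + x (2/3 + x/9) ≤ 1 + x because 7/9 ≤ 1, and the product of the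
-- factors 1 + 1/j telescopes.
g²≤ : ∀ n → g n * g n ≤ ℕ→ℚ (suc n)
g²≤ zero    = ≤-refl
g²≤ (suc n) = begin
  g (suc n) * g (suc n)                             ≡⟨ solve 2 (λ g x → (g :* (con 1ℚ :+ con (+ 1 / 3) :* x)) :* (g :* (con 1ℚ :+ con (+ 1 / 3) :* x)) := (g :* g) :* (con 1ℚ :+ x :* (con (+ 2 / 3) :+ con (+ 1 / 9) :* x))) refl (g n) x ⟩
  (g n * g n) * (1ℚ + x * (+ 2 / 3 + (+ 1 / 9) * x)) ≤⟨ *-mono-≤ (0≤* (0≤g n) (0≤g n)) (g²≤ n)
       (0≤+ 0≤1 (0≤* (0≤inv (suc n)) (0≤+ (nonNegative⁻¹ (+ 2 / 3)) (0≤* (nonNegative⁻¹ (+ 1 / 9)) (0≤inv (suc n))))))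
       (+-monoʳ-≤ 1ℚ (*-monoˡ (0≤inv (suc n)) (≤-trans (+-monoʳ-≤ (+ 2 / 3) (*-monoˡ (nonNegative⁻¹ (+ 1 / 9)) (inv≤1 (suc n)))) (*≤* (ℤ.+≤+ (ℕ.m≤m+n 7 2)))))) ⟩
  ℕ→ℚ (suc n) * (1ℚ + x * 1ℚ)                       ≡⟨ solve 2 (λ k x → k :* (con 1ℚ :+ x :* con 1ℚ) := k :* x :+ k) refl (ℕ→ℚ (suc n)) x ⟩
  ℕ→ℚ (suc n) * x + ℕ→ℚ (suc n)                     ≡⟨ cong (_+ ℕ→ℚ (suc n)) (inv-inverse n) ⟩
  1ℚ + ℕ→ℚ (suc n)                                  ≡⟨ ℕ→ℚ-homo-+ 1 (suc n) ⟨
  ℕ→ℚ (2 ℕ.+ n) ∎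
  where open ≤-Reasoning
        open +-*-Solver
        x = inv (suc n)

-- Of order n^(-2/3). Up to constants it bounds both `Λ n ^ k` / (n+1) and the tails of the sum of
-- `Λ n ^ k` / n².
t : ℕ → ℚ
t n = g n * inv (suc n)

0≤t : ∀ n → 0ℚ ≤ t n
0≤t n = 0≤* (0≤g n) (0≤inv (suc n))

t²≤ : ∀ n → t n * t n ≤ inv (suc n)
t²≤ n = begin
  t n * t n              ≡⟨ solve 2 (λ g x → (g :* x) :* (g :* x) := (g :* g) :* (x :* x)) refl (g n) x ⟩
  (g n * g n) * (x * x)  ≤⟨ *-monoʳ (0≤* (0≤inv (suc n)) (0≤inv (suc n))) (g²≤ n) ⟩
  ℕ→ℚ (suc n) * (x * x)  ≡⟨ *-assoc (ℕ→ℚ (suc n)) x x ⟨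
  ℕ→ℚ (suc n) * x * x    ≡⟨ cong (_* x) (inv-inverse n) ⟩
  1ℚ * x                 ≡⟨ *-identityˡ x ⟩
  x ∎
  where open ≤-Reasoning
        open +-*-Solver
        x = inv (suc n)

-- Squaring replaces a root: ε ≤ `t n` would give ε² ≤ 1/(n+1), against the choice of N for ε².
Null-t : Null t
Null-t ε 0<ε = proj₁ arch , λ n n≥ → ≰⇒> λ ε≤t → <-irrefl refl (begin-strict
  ε * ε                 ≤⟨ *-mono-≤ (<⇒≤ 0<ε) ε≤t (<⇒≤ 0<ε) ε≤t ⟩
  t n * t n             ≤⟨ t²≤ n ⟩
  inv (suc n)           ≤⟨ inv-anti n≥ ⟩
  inv (suc (proj₁ arch)) <⟨ proj₂ arch ⟩
  ε * ε ∎)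
  where
  open ≤-Reasoning
  arch = archimedean (ε * ε) (subst (_< ε * ε) (*-zeroʳ ε) (*-monoʳ-<-pos ε {{positive 0<ε}} 0<ε))

-- Summed over n ≥ N, this bounds the tail of Σ g(n)/n² by 6 t(N).
t-telescope : ∀ n → g (suc n) * (inv (suc n) * inv (suc n)) + ℕ→ℚ 6 * t (suc n) ≤ ℕ→ℚ 6 * t n
t-telescope n = begin
  g (suc n) * (x * x) + ℕ→ℚ 6 * t (suc n)
    ≤⟨ +-monoˡ-≤ (ℕ→ℚ 6 * t (suc n)) (*-monoˡ (0≤g (suc n)) (*-monoˡ (0≤inv (suc n)) x≤2z)) ⟩
  g (suc n) * (x * (ℕ→ℚ 2 * z)) + ℕ→ℚ 6 * t (suc n)
    ≤⟨ +-monoˡ-≤ (ℕ→ℚ 6 * t (suc n)) (*-monoʳ (0≤* (0≤inv (suc n)) (0≤* (0≤ℕ→ℚ 2) (0≤inv (2 ℕ.+ n)))) (g-suc-≤ n)) ⟩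
  (ℕ→ℚ 2 * g n) * (x * (ℕ→ℚ 2 * z)) + ℕ→ℚ 6 * t (suc n)
    -- The constant 6 comes from 6 (1 - 1/3) = 4 = 2 · 2: growth of `g` eats a third of the decrease
    -- of 6 `t`, and the rest pays for the two crude factors 2.
    ≡⟨ solve 3 (λ g x z → (con (ℕ→ℚ 2) :* g) :* (x :* (con (ℕ→ℚ 2) :* z)) :+ con (ℕ→ℚ 6) :* ((g :* (con 1ℚ :+ con (+ 1 / 3) :* x)) :* z)
          := con (ℕ→ℚ 6) :* (g :* (z :+ x :* z))) refl (g n) x z ⟩
  ℕ→ℚ 6 * (g n * (z + x * z))  ≡⟨ cong (λ q → ℕ→ℚ 6 * (g n * q)) (inv-suc n) ⟨
  ℕ→ℚ 6 * t n ∎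
  where
  open ≤-Reasoning
  open +-*-Solver
  x = inv (suc n)
  z = inv (2 ℕ.+ n)
  x≤2z : x ≤ ℕ→ℚ 2 * z
  x≤2z = begin
    x         ≡⟨ inv-suc n ⟩
    z + x * z ≤⟨ +-monoʳ-≤ z (*-monoʳ (0≤inv (2 ℕ.+ n)) (inv≤1 (suc n))) ⟩
    z + 1ℚ * z ≡⟨ solve 1 (λ z → z :+ con 1ℚ :* z := con (ℕ→ℚ 2) :* z) refl z ⟩
    ℕ→ℚ 2 * z ∎

-- Powers of harmonic numbers grow slowly.

-- The common unit of size: 2 H covers a sum of weights of size at most 2/n, and the extra 2 covers
-- a single weight. Each further factor or nested sum then costs one power of `Λ`.
Λ : ℕ → ℚ
Λ n = ℕ→ℚ 2 * (1ℚ + H n)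

0≤H : ∀ n → 0ℚ ≤ H n
0≤H zero    = ≤-refl
0≤H (suc n) = 0≤+ (0≤H n) (0≤inv (suc n))

2≤Λ : ∀ n → ℕ→ℚ 2 ≤ Λ n
2≤Λ n = subst (_≤ Λ n) (*-identityʳ (ℕ→ℚ 2)) (*-monoˡ (0≤ℕ→ℚ 2) (p≤p+q (0≤H n)))

1+H≤Λ : ∀ n → 1ℚ + H n ≤ Λ n
1+H≤Λ n = subst (1ℚ + H n ≤_) (solve 1 (λ a → a :+ a := con (ℕ→ℚ 2) :* a) refl (1ℚ + H n)) (p≤p+q (0≤+ 0≤1 (0≤H n)))
  where open +-*-Solver

0≤Λ : ∀ n → 0ℚ ≤ Λ n
0≤Λ n = ≤-trans (0≤ℕ→ℚ 2) (2≤Λ n)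

0≤Λ^ : ∀ n k → 0ℚ ≤ Λ n ^ k
0≤Λ^ n k = ^-nonNeg k (0≤Λ n)

Λ-suc : ∀ n → Λ (suc n) ≡ Λ n + ℕ→ℚ 2 * inv (suc n)
Λ-suc n = solve 2 (λ h x → con (ℕ→ℚ 2) :* (con 1ℚ :+ (h :+ x)) := con (ℕ→ℚ 2) :* (con 1ℚ :+ h) :+ con (ℕ→ℚ 2) :* x) refl (H n) (inv (suc n))
  where open +-*-Solver

Λ-suc-≤ : ∀ n → Λ n ≤ Λ (suc n)
Λ-suc-≤ n = subst (Λ n ≤_) (sym (Λ-suc n)) (p≤p+q (0≤* (0≤ℕ→ℚ 2) (0≤inv (suc n))))

-- The mean value inequality for the power k + 1, by induction on k.
[a+d]^-≤ : ∀ {a d} k → 0ℚ ≤ a → 0ℚ ≤ d → (a + d) ^ suc k ≤ a ^ suc k + ℕ→ℚ (suc k) * (d * (a + d) ^ k)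
[a+d]^-≤ {a} {d} zero 0≤a 0≤d = ≤-reflexive
  (solve 2 (λ a d → (a :+ d) :* con 1ℚ := a :* con 1ℚ :+ con 1ℚ :* (d :* con 1ℚ)) refl a d)
  where open +-*-Solver
[a+d]^-≤ {a} {d} (suc k) 0≤a 0≤d = begin
  (a + d) * e                            ≡⟨ *-distribʳ-+ e a d ⟩
  a * e + d * e                          ≤⟨ +-monoˡ-≤ (d * e) (*-monoˡ 0≤a ([a+d]^-≤ k 0≤a 0≤d)) ⟩
  a * (a ^ suc k + s * (d * f)) + d * e  ≡⟨ solve 6 (λ a A s d f e → a :* (A :+ s :* (d :* f)) :+ d :* e := a :* A :+ (s :* d :* (a :* f) :+ d :* e)) refl a (a ^ suc k) s d f e ⟩
  a * a ^ suc k + (s * d * (a * f) + d * e) ≤⟨ +-monoʳ-≤ (a * a ^ suc k) (+-monoˡ-≤ (d * e) (*-monoˡ (0≤* (0≤ℕ→ℚ (suc k)) 0≤d) (*-monoʳ (^-nonNeg k (0≤+ 0≤a 0≤d)) (p≤p+q {a} 0≤d)))) ⟩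
  a * a ^ suc k + (s * d * e + d * e)    ≡⟨ cong (λ q → a * a ^ suc k + q) (solve 3 (λ s d e → s :* d :* e :+ d :* e := (con 1ℚ :+ s) :* (d :* e)) refl s d e) ⟩
  a * a ^ suc k + (1ℚ + s) * (d * e)     ≡⟨ cong (λ q → a * a ^ suc k + q * (d * e)) (ℕ→ℚ-homo-+ 1 (suc k)) ⟨
  a * a ^ suc k + ℕ→ℚ (2 ℕ.+ k) * (d * e) ∎
  where
  open ≤-Reasoning
  open +-*-Solver
  s = ℕ→ℚ (suc k)
  e = (a + d) ^ suc k
  f = (a + d) ^ k

-- By induction on k: the increment of `Λ ^ suc k` is of order `Λ ^ k` / n, hence by the previous
-- exponent of order `g n` / n, which is the order of the increment of `g` itself.
Λ^k≤cg : ∀ k → Σ ℚ λ c → 0ℚ ≤ c × (∀ n → Λ n ^ k ≤ c * g n)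
Λ^k≤cg zero    = 1ℚ , 0≤1 , 1≤g
  where
  1≤g : ∀ n → 1ℚ ≤ 1ℚ * g n
  1≤g zero    = ≤-refl
  1≤g (suc n) = ≤-trans (1≤g n) (*-monoˡ 0≤1 (subst (_≤ g (suc n)) (*-identityʳ (g n))
    (*-monoˡ (0≤g n) (p≤p+q (0≤* (nonNegative⁻¹ (+ 1 / 3)) (0≤inv (suc n)))))))
Λ^k≤cg (suc k) = c′ , 0≤c′ , bound
  where
  open ≤-Reasoning
  open +-*-Solver
  c   = proj₁ (Λ^k≤cg k)
  0≤c = proj₁ (proj₂ (Λ^k≤cg k))
  s   = ℕ→ℚ (suc k)
  c₁  = Λ 0 ^ suc k
  -- With x = 1/(n+1), the increment is at most s · 2x · c · 2 `g n` = 4 s c x `g n`, while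
  -- `c′ * g n` gains a third of c′ x `g n`; hence 12. The summand `c₁` settles n = 0.
  c′  = c₁ + ℕ→ℚ 12 * (s * c)
  0≤sc : 0ℚ ≤ ℕ→ℚ 12 * (s * c)
  0≤sc = 0≤* (0≤ℕ→ℚ 12) (0≤* (0≤ℕ→ℚ (suc k)) 0≤c)
  0≤c′ : 0ℚ ≤ c′
  0≤c′ = 0≤+ (0≤Λ^ 0 (suc k)) 0≤sc
  bound : ∀ n → Λ n ^ suc k ≤ c′ * g n
  bound zero    = subst (c₁ ≤_) (sym (*-identityʳ c′)) (p≤p+q 0≤sc)
  bound (suc n) = begin
    Λ (suc n) ^ suc k               ≡⟨ cong (_^ suc k) (Λ-suc n) ⟩
    (Λ n + ℕ→ℚ 2 * x) ^ suc k       ≤⟨ [a+d]^-≤ k (0≤Λ n) 0≤2x ⟩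
    Λ n ^ suc k + s * (ℕ→ℚ 2 * x * (Λ n + ℕ→ℚ 2 * x) ^ k) ≡⟨ cong (λ q → Λ n ^ suc k + s * (ℕ→ℚ 2 * x * q ^ k)) (Λ-suc n) ⟨
    Λ n ^ suc k + s * (ℕ→ℚ 2 * x * Λ (suc n) ^ k)
      ≤⟨ +-mono-≤ (bound n) (*-monoˡ (0≤ℕ→ℚ (suc k)) (*-monoˡ 0≤2x (≤-trans (proj₂ (proj₂ (Λ^k≤cg k)) (suc n)) (*-monoˡ 0≤c (g-suc-≤ n))))) ⟩
    c′ * g n + s * (ℕ→ℚ 2 * x * (c * (ℕ→ℚ 2 * g n)))
      -- The gain of `c₁ * g n` is surplus; adding it turns the remaining step into an identity.
      ≤⟨ p≤p+q (0≤* (0≤* (nonNegative⁻¹ (+ 1 / 3)) (0≤Λ^ 0 (suc k))) (0≤* (0≤g n) (0≤inv (suc n)))) ⟩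
    c′ * g n + s * (ℕ→ℚ 2 * x * (c * (ℕ→ℚ 2 * g n))) + (+ 1 / 3) * c₁ * (g n * x)
      ≡⟨ solve 5 (λ c₁ s c g x → (c₁ :+ con (ℕ→ℚ 12) :* (s :* c)) :* g :+ s :* (con (ℕ→ℚ 2) :* x :* (c :* (con (ℕ→ℚ 2) :* g))) :+ con (+ 1 / 3) :* c₁ :* (g :* x)
           := (c₁ :+ con (ℕ→ℚ 12) :* (s :* c)) :* (g :* (con 1ℚ :+ con (+ 1 / 3) :* x))) refl c₁ s c (g n) x ⟩
    c′ * g (suc n) ∎
    where
    x = inv (suc n)
    0≤2x : 0ℚ ≤ ℕ→ℚ 2 * x
    0≤2x = 0≤* (0≤ℕ→ℚ 2) (0≤inv (suc n))

Null-Λ^/ : ∀ k → Null (λ n → Λ n ^ k * inv (suc n))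
Null-Λ^/ k = let c , 0≤c , bd = Λ^k≤cg k in
  Null-≤ (λ n → subst (Λ n ^ k * inv (suc n) ≤_) (*-assoc c (g n) (inv (suc n))) (*-monoʳ (0≤inv (suc n)) (bd n)))
         (Null-* c 0≤c Null-t)

-- Cauchy sequences and common limits.

∣x-y∣≤ : ∀ {a r x y} → a ≤ x → x ≤ a + r → a ≤ y → y ≤ a + r → ∣ x - y ∣ ≤ r
∣x-y∣≤ {a} {r} {x} {y} a≤x x≤ a≤y y≤ with ∣p∣≡p∨∣p∣≡-p (x - y)
... | inj₁ eq = subst (_≤ r) (sym eq) (subst (x - y ≤_) lemma (+-mono-≤ x≤ (neg-antimono-≤ a≤y)))
  where open +-*-Solver
        lemma : a + r - a ≡ r
        lemma = solve 2 (λ a r → a :+ r :- a := r) refl a r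
... | inj₂ eq = subst (_≤ r) (sym (trans eq (solve 2 (λ x y → :- (x :- y) := y :- x) refl x y)))
                  (subst (y - x ≤_) lemma (+-mono-≤ y≤ (neg-antimono-≤ a≤x)))
  where open +-*-Solver
        lemma : a + r - a ≡ r
        lemma = solve 2 (λ a r → a :+ r :- a := r) refl a r

sumTo-mono : ∀ {f} → (∀ n → 0ℚ ≤ f n) → ∀ {N M} → N ℕ.≤ M → sumTo N f ≤ sumTo M f
sumTo-mono {f} 0≤f N≤M = go (ℕ.≤⇒≤′ N≤M)
  where
  go : ∀ {N M} → N ℕ.≤′ M → sumTo N f ≤ sumTo M f
  go (ℕ.≤′-reflexive refl) = ≤-refl
  go (ℕ.≤′-step {n = M} p) = ≤-trans (go p) (p≤p+q (0≤f (suc M)))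

-- The partial sums increase, while partial sum plus `r` decreases because `r n` dominates the next
-- term plus `r (suc n)`. So all partial sums from N on lie in one interval of length `r N`.
cauchy-sum : ∀ {f} k → (∀ n → 0ℚ ≤ f n) → (∀ n → f (suc n) ≤ Λ (suc n) ^ k * (inv (suc n) * inv (suc n))) →
  Cauchy (λ M → sumTo M f)
cauchy-sum {f} k 0≤f f≤ ε 0<ε = N , λ M K M≥N K≥N → ≤-<-trans
    (∣x-y∣≤ (sumTo-mono 0≤f M≥N) (upper M≥N) (sumTo-mono 0≤f K≥N) (upper K≥N))
    (small N ℕ.≤-refl)
  where
  open ≤-Reasoning
  open +-*-Solver
  c   = proj₁ (Λ^k≤cg k)
  0≤c = proj₁ (proj₂ (Λ^k≤cg k))
  r : ℕ → ℚ
  r n = c * (ℕ→ℚ 6 * t n)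
  0≤r : ∀ n → 0ℚ ≤ r n
  0≤r n = 0≤* 0≤c (0≤* (0≤ℕ→ℚ 6) (0≤t n))
  r→0 : Null r
  r→0 = Null-* c 0≤c (Null-* (ℕ→ℚ 6) (0≤ℕ→ℚ 6) Null-t)
  N     = proj₁ (r→0 ε 0<ε)
  small = proj₂ (r→0 ε 0<ε)
  step : ∀ n → f (suc n) + r (suc n) ≤ r n
  step n = begin
    f (suc n) + r (suc n)  ≤⟨ +-monoˡ-≤ (r (suc n)) (≤-trans (f≤ n) (*-monoʳ (0≤* (0≤inv (suc n)) (0≤inv (suc n))) (proj₂ (proj₂ (Λ^k≤cg k)) (suc n)))) ⟩
    c * g (suc n) * (x * x) + r (suc n) ≡⟨ solve 4 (λ c g x r → c :* g :* x :+ c :* r := c :* (g :* x :+ r)) refl c (g (suc n)) (x * x) (ℕ→ℚ 6 * t (suc n)) ⟩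
    c * (g (suc n) * (x * x) + ℕ→ℚ 6 * t (suc n)) ≤⟨ *-monoˡ 0≤c (t-telescope n) ⟩
    r n ∎
    where x = inv (suc n)
  decreasing : ∀ {A B} → A ℕ.≤′ B → sumTo B f + r B ≤ sumTo A f + r A
  decreasing (ℕ.≤′-reflexive refl) = ≤-refl
  decreasing {A} (ℕ.≤′-step {n = B} p) = begin
    sumTo B f + f (suc B) + r (suc B)   ≡⟨ +-assoc (sumTo B f) (f (suc B)) (r (suc B)) ⟩
    sumTo B f + (f (suc B) + r (suc B)) ≤⟨ +-monoʳ-≤ (sumTo B f) (step B) ⟩
    sumTo B f + r B                     ≤⟨ decreasing p ⟩
    sumTo A f + r A ∎
  upper : ∀ {M} → M ℕ.≥ N → sumTo M f ≤ sumTo N f + r N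
  upper {M} M≥N = ≤-trans (p≤p+q (0≤r M)) (decreasing (ℕ.≤⇒≤′ M≥N))

SameLimit-refl : ∀ {a} → SameLimit a a
SameLimit-refl {a} ε 0<ε = 0 , λ M _ → subst (λ x → ∣ x ∣ < ε) (sym (+-inverseʳ (a M))) 0<ε

SameLimit-sym : ∀ {a b} → SameLimit a b → SameLimit b a
SameLimit-sym {a} {b} a~b ε 0<ε = let N , h = a~b ε 0<ε in N , λ M M≥N → subst (_< ε) (∣p-q∣≡∣q-p∣ (a M) (b M)) (h M M≥N)
  where
  open +-*-Solver
  ∣p-q∣≡∣q-p∣ : ∀ p q → ∣ p - q ∣ ≡ ∣ q - p ∣
  ∣p-q∣≡∣q-p∣ p q = trans (sym (∣-p∣≡∣p∣ (p - q))) (cong ∣_∣ (solve 2 (λ p q → :- (p :- q) := q :- p) refl p q))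

∣-∣-triangle : ∀ p q r → ∣ p - r ∣ ≤ ∣ p - q ∣ + ∣ q - r ∣
∣-∣-triangle p q r = subst (λ s → ∣ s ∣ ≤ ∣ p - q ∣ + ∣ q - r ∣)
  (solve 3 (λ p q r → (p :- q) :+ (q :- r) := p :- r) refl p q r) (∣p+q∣≤∣p∣+∣q∣ (p - q) (q - r))
  where open +-*-Solver

SameLimit-trans : ∀ {a b c} → SameLimit a b → SameLimit b c → SameLimit a c
SameLimit-trans {a} {b} {c} a~b b~c = Null-≤ (λ M → ∣-∣-triangle (a M) (b M) (c M)) (Null-+ a~b b~c)

SameLimit-≡ : ∀ {a a′ b b′} → (∀ M → a M ≡ a′ M) → (∀ M → b M ≡ b′ M) → SameLimit a b → SameLimit a′ b′
SameLimit-≡ {a} {a′} {b} {b′} p q = Null-≤ {λ M → ∣ a′ M - b′ M ∣} {λ M → ∣ a M - b M ∣}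
  λ M → ≤-reflexive (cong₂ (λ x y → ∣ x - y ∣) (sym (p M)) (sym (q M)))

SameLimit-+ : ∀ {a b r s : ℕ → ℚ} → (∀ M → a M ≡ b M + r M) → (∀ M → 0ℚ ≤ r M) → (∀ M → r M ≤ s M) → Null s → SameLimit a b
SameLimit-+ {a} {b} {r} {s} a≡b+r 0≤r r≤s = Null-≤ λ M →
  ∣x-y∣≤ (subst (b M ≤_) (sym (a≡b+r M)) (p≤p+q (0≤r M)))
         (subst (_≤ b M + s M) (sym (a≡b+r M)) (+-monoʳ-≤ (b M) (r≤s M)))
         ≤-refl (p≤p+q (≤-trans (0≤r M) (r≤s M)))

Cauchy-SameLimit : ∀ {a b} → Cauchy a → SameLimit a b → Cauchy b
Cauchy-SameLimit {a} {b} ca a~b ε 0<ε =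
  let δ = half ε; 0<δ = 0<half 0<ε
      η = half δ; 0<η = 0<half 0<δ
      N₁ , h₁ = ca δ 0<δ
      N₂ , h₂ = a~b η 0<η
      N₃ , h₃ = SameLimit-sym {a} {b} a~b η 0<η
  in N₁ ℕ.+ (N₂ ℕ.+ N₃) , λ M K M≥ K≥ → begin-strict
    ∣ b M - b K ∣                                          ≤⟨ ∣-∣-triangle (b M) (a M) (b K) ⟩
    ∣ b M - a M ∣ + ∣ a M - b K ∣                          ≤⟨ +-monoʳ-≤ (∣ b M - a M ∣) (∣-∣-triangle (a M) (a K) (b K)) ⟩
    ∣ b M - a M ∣ + (∣ a M - a K ∣ + ∣ a K - b K ∣)
      <⟨ +-mono-< (h₃ M (ℕ.≤-trans (ℕ.≤-trans (ℕ.m≤n+m N₃ N₂) (ℕ.m≤n+m (N₂ ℕ.+ N₃) N₁)) M≥))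
         (+-mono-< (h₁ M K (ℕ.≤-trans (ℕ.m≤m+n N₁ _) M≥) (ℕ.≤-trans (ℕ.m≤m+n N₁ _) K≥))
                   (h₂ K (ℕ.≤-trans (ℕ.≤-trans (ℕ.m≤m+n N₂ N₃) (ℕ.m≤n+m (N₂ ℕ.+ N₃) N₁)) K≥))) ⟩
    η + (δ + η)  ≡⟨ trans (cong (λ q → η + q) (+-comm δ η)) (sym (+-assoc η η δ)) ⟩
    η + η + δ    ≡⟨ cong (_+ δ) (half+half δ) ⟩
    δ + δ        ≡⟨ half+half ε ⟩
    ε ∎
  where open ≤-Reasoning

-- Dual numbers.

-- a +ε b stands for a − b·dx with dx² = 0; with this sign the weights and the kernel below are nonnegative.
infix 5 _+ε_
record Dual : Set where
  constructor _+ε_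
  field
    re : ℚ
    du : ℚ

open Dual

infixl 6 _⊕_
infixl 7 _⊗_

_⊕_ : Dual → Dual → Dual
(a +ε a′) ⊕ (b +ε b′) = a + b +ε a′ + b′

_⊗_ : Dual → Dual → Dual
(a +ε a′) ⊗ (b +ε b′) = a * b +ε a * b′ + a′ * b

0ᴰ 1ᴰ : Dual
0ᴰ = 0ℚ +ε 0ℚ
1ᴰ = 1ℚ +ε 0ℚ

-- A semiring suffices for the solver, since the identities between dual numbers are arranged
-- without subtraction.
dualCommutativeSemiring : CommutativeSemiring 0ℓ 0ℓ
dualCommutativeSemiring = record
  { Carrier = Dual ; _≈_ = _≡_ ; _+_ = _⊕_ ; _*_ = _⊗_ ; 0# = 0ᴰ ; 1# = 1ᴰ
  ; isCommutativeSemiring = isCommutativeSemiringˡ record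
    { +-isCommutativeMonoid = record
      { isMonoid = record
        { isSemigroup = record
          { isMagma = record { isEquivalence = isEquivalence ; ∙-cong = cong₂ _⊕_ }
          ; assoc = λ (a +ε a′) (b +ε b′) (c +ε c′) → cong₂ _+ε_ (+-assoc a b c) (+-assoc a′ b′ c′)
          }
        ; identity = (λ (a +ε a′) → cong₂ _+ε_ (+-identityˡ a) (+-identityˡ a′))
                   , (λ (a +ε a′) → cong₂ _+ε_ (+-identityʳ a) (+-identityʳ a′))
        }
      ; comm = λ (a +ε a′) (b +ε b′) → cong₂ _+ε_ (+-comm a b) (+-comm a′ b′)
      }
    ; *-isCommutativeMonoid = record
      { isMonoid = record
        { isSemigroup = record
          { isMagma = record { isEquivalence = isEquivalence ; ∙-cong = cong₂ _⊗_ }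
          ; assoc = λ (a +ε a′) (b +ε b′) (c +ε c′) → cong₂ _+ε_ (*-assoc a b c)
              (solve 6 (λ a a′ b b′ c c′ → a :* b :* c′ :+ (a :* b′ :+ a′ :* b) :* c := a :* (b :* c′ :+ b′ :* c) :+ a′ :* (b :* c)) refl a a′ b b′ c c′)
          }
        ; identity = (λ (a +ε a′) → cong₂ _+ε_ (*-identityˡ a) (solve 2 (λ a a′ → con 1ℚ :* a′ :+ con 0ℚ :* a := a′) refl a a′))
                   , (λ (a +ε a′) → cong₂ _+ε_ (*-identityʳ a) (solve 2 (λ a a′ → a :* con 0ℚ :+ a′ :* con 1ℚ := a′) refl a a′))
        }
      ; comm = λ (a +ε a′) (b +ε b′) → cong₂ _+ε_ (*-comm a b)
          (solve 4 (λ a a′ b b′ → a :* b′ :+ a′ :* b := b :* a′ :+ b′ :* a) refl a a′ b b′)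
      }
    ; distribʳ = λ (a +ε a′) (b +ε b′) (c +ε c′) → cong₂ _+ε_ (*-distribʳ-+ a b c)
        (solve 6 (λ a a′ b b′ c c′ → (b :+ c) :* a′ :+ (b′ :+ c′) :* a := b :* a′ :+ b′ :* a :+ (c :* a′ :+ c′ :* a)) refl a a′ b b′ c c′)
    ; zeroˡ = λ (a +ε a′) → cong₂ _+ε_ (*-zeroˡ a) (solve 2 (λ a a′ → con 0ℚ :* a′ :+ con 0ℚ :* a := con 0ℚ) refl a a′)
    }
  }
  where open +-*-Solver

module ⊕⊗ = CommutativeSemiring dualCommutativeSemiring
module ⊕⊗-Solver = SemiringSolver dualCommutativeSemiring

-- Finite sums, connected sums and Abel summation.

-- Unlike `sumTo`, the index runs from 0 to n - 1: the strict bound expresses n_i > n_{i+1}, and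
-- index 0 is reserved for the seed `δ₀`.
∑ : ℕ → (ℕ → Dual) → Dual
∑ zero    f = 0ᴰ
∑ (suc n) f = ∑ n f ⊕ f n

∑-cong : ∀ {f g} → (∀ n → f n ≡ g n) → ∀ n → ∑ n f ≡ ∑ n g
∑-cong f≡g zero    = refl
∑-cong f≡g (suc n) = cong₂ _⊕_ (∑-cong f≡g n) (f≡g n)

∑-⊕ : ∀ f g n → ∑ n (λ i → f i ⊕ g i) ≡ ∑ n f ⊕ ∑ n g
∑-⊕ f g zero    = refl
∑-⊕ f g (suc n) = trans (cong (_⊕ (f n ⊕ g n)) (∑-⊕ f g n))
  (solve 4 (λ a b c d → (a :+ b) :+ (c :+ d) := (a :+ c) :+ (b :+ d)) refl (∑ n f) (∑ n g) (f n) (g n))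
  where open ⊕⊗-Solver

∑-⊗ʳ : ∀ f c n → ∑ n (λ i → f i ⊗ c) ≡ ∑ n f ⊗ c
∑-⊗ʳ f c zero    = sym (⊕⊗.zeroˡ c)
∑-⊗ʳ f c (suc n) = trans (cong (_⊕ f n ⊗ c) (∑-⊗ʳ f c n)) (sym (⊕⊗.distribʳ c (∑ n f) (f n)))

∑-⊗ˡ : ∀ f c n → ∑ n (λ i → c ⊗ f i) ≡ c ⊗ ∑ n f
∑-⊗ˡ f c n = trans (∑-cong (λ i → ⊕⊗.*-comm c (f i)) n) (trans (∑-⊗ʳ f c n) (⊕⊗.*-comm (∑ n f) c))

∑-0 : ∀ n → ∑ n (λ _ → 0ᴰ) ≡ 0ᴰ
∑-0 zero    = refl
∑-0 (suc n) = trans (⊕⊗.+-identityʳ _) (∑-0 n)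

∑-swap : ∀ (f : ℕ → ℕ → Dual) m n → ∑ m (λ i → ∑ n (f i)) ≡ ∑ n (λ j → ∑ m (λ i → f i j))
∑-swap f zero    n = sym (∑-0 n)
∑-swap f (suc m) n = trans (cong (_⊕ ∑ n (f m)) (∑-swap f m n)) (sym (∑-⊕ (λ j → ∑ m (λ i → f i j)) (f m) n))

Kernel : Set
Kernel = ℕ → ℕ → Dual

_ᵀ : Kernel → Kernel
(K ᵀ) n m = K m n

pair : Kernel → (ℕ → Dual) → (ℕ → Dual) → ℕ → Dual
pair K F G M = ∑ (suc M) λ n → F n ⊗ ∑ (suc M) λ m → K n m ⊗ G m

pair-ᵀ : ∀ K F G M → pair (K ᵀ) G F M ≡ pair K F G M
pair-ᵀ K F G M = begin
  ∑ (suc M) (λ m → G m ⊗ ∑ (suc M) (λ n → K n m ⊗ F n))   ≡⟨ ∑-cong (λ m → sym (∑-⊗ˡ (λ n → K n m ⊗ F n) (G m) (suc M))) (suc M) ⟩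
  ∑ (suc M) (λ m → ∑ (suc M) (λ n → G m ⊗ (K n m ⊗ F n))) ≡⟨ ∑-swap (λ m n → G m ⊗ (K n m ⊗ F n)) (suc M) (suc M) ⟩
  ∑ (suc M) (λ n → ∑ (suc M) (λ m → G m ⊗ (K n m ⊗ F n))) ≡⟨ ∑-cong (λ n → ∑-cong (λ m → solve 3 (λ g k f → g :* (k :* f) := f :* (k :* g)) refl (G m) (K n m) (F n)) (suc M)) (suc M) ⟩
  ∑ (suc M) (λ n → ∑ (suc M) (λ m → F n ⊗ (K n m ⊗ G m))) ≡⟨ ∑-cong (λ n → ∑-⊗ˡ (λ m → K n m ⊗ G m) (F n) (suc M)) (suc M) ⟩
  pair K F G M ∎
  where open ≡-Reasoning
        open ⊕⊗-Solver

-- The kernel relation u(n) (K(n,m) - K(n,m+1)) = v(m+1) K(n,m+1) with the subtraction moved across;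
-- telescoping it gives the sum over b > m. Row 0 is left out: for the kernel used below, `u 0`
-- vanishes while `K 0 m` is 1.
Transports : (ℕ → Dual) → (ℕ → Dual) → Kernel → Set
Transports u v K = ∀ n m →
  u (suc n) ⊗ K (suc n) m ≡ u (suc n) ⊗ K (suc n) (suc m) ⊕ v (suc m) ⊗ K (suc n) (suc m)

module _ {u v : ℕ → Dual} {K : Kernel} (tr : Transports u v K) where

  -- Abel summation in m; the boundary term at m = M is what vanishes in the limit.
  transport-row : ∀ G n M →
    u (suc n) ⊗ ∑ (suc M) (λ m → K (suc n) m ⊗ G m)
    ≡ ∑ (suc M) (λ m → K (suc n) m ⊗ (v m ⊗ ∑ m G)) ⊕ u (suc n) ⊗ K (suc n) M ⊗ ∑ (suc M) G
  transport-row G n zero =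
    solve 4 (λ a k b c → a :* (con 0 :+ k :* c) := (con 0 :+ k :* (b :* con 0)) :+ a :* k :* (con 0 :+ c)) refl (u (suc n)) (K (suc n) 0) (v 0) (G 0)
    where open ⊕⊗-Solver
  transport-row G n (suc M) = begin
    a ⊗ (S ⊕ k′ ⊗ c)                        ≡⟨ ⊕⊗.distribˡ a S (k′ ⊗ c) ⟩
    a ⊗ S ⊕ a ⊗ (k′ ⊗ c)                    ≡⟨ cong (_⊕ a ⊗ (k′ ⊗ c)) (transport-row G n M) ⟩
    T ⊕ a ⊗ k ⊗ s ⊕ a ⊗ (k′ ⊗ c)            ≡⟨ cong (λ q → T ⊕ q ⊗ s ⊕ a ⊗ (k′ ⊗ c)) (tr n M) ⟩
    T ⊕ (a ⊗ k′ ⊕ b ⊗ k′) ⊗ s ⊕ a ⊗ (k′ ⊗ c) ≡⟨ solve 6 (λ T a k b s c → T :+ (a :* k :+ b :* k) :* s :+ a :* (k :* c) := (T :+ k :* (b :* s)) :+ a :* k :* (s :+ c)) refl T a k′ b s c ⟩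
    T ⊕ k′ ⊗ (b ⊗ s) ⊕ a ⊗ k′ ⊗ (s ⊕ c) ∎
    where
    open ≡-Reasoning
    open ⊕⊗-Solver
    a = u (suc n)
    b = v (suc M)
    k = K (suc n) M
    k′ = K (suc n) (suc M)
    c = G (suc M)
    s = ∑ (suc M) G
    S = ∑ (suc M) (λ m → K (suc n) m ⊗ G m)
    T = ∑ (suc M) (λ m → K (suc n) m ⊗ (v m ⊗ ∑ m G))

  -- A factor `u` on one side becomes one more nested sum with weight `v` on the other. The
  -- hypothesis on `F 0` removes row 0, where `tr` says nothing.
  transport : ∀ F G M → F 0 ≡ 0ᴰ →
    pair K (λ n → u n ⊗ F n) G M
    ≡ pair K F (λ m → v m ⊗ ∑ m G) M ⊕ ∑ (suc M) (λ n → u n ⊗ F n ⊗ K n M) ⊗ ∑ (suc M) G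
  transport F G M F0≡0 = begin
    ∑ (suc M) (λ n → u n ⊗ F n ⊗ row n)                ≡⟨ ∑-cong each (suc M) ⟩
    ∑ (suc M) (λ n → F n ⊗ row′ n ⊕ u n ⊗ F n ⊗ K n M ⊗ s) ≡⟨ ∑-⊕ (λ n → F n ⊗ row′ n) (λ n → u n ⊗ F n ⊗ K n M ⊗ s) (suc M) ⟩
    pair K F G′ M ⊕ ∑ (suc M) (λ n → u n ⊗ F n ⊗ K n M ⊗ s) ≡⟨ cong (pair K F G′ M ⊕_) (∑-⊗ʳ (λ n → u n ⊗ F n ⊗ K n M) s (suc M)) ⟩
    pair K F G′ M ⊕ ∑ (suc M) (λ n → u n ⊗ F n ⊗ K n M) ⊗ s ∎
    where
    open ≡-Reasoning
    open ⊕⊗-Solver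
    G′ = λ m → v m ⊗ ∑ m G
    s = ∑ (suc M) G
    row row′ : ℕ → Dual
    row  n = ∑ (suc M) (λ m → K n m ⊗ G m)
    row′ n = ∑ (suc M) (λ m → K n m ⊗ G′ m)
    each : ∀ n → u n ⊗ F n ⊗ row n ≡ F n ⊗ row′ n ⊕ u n ⊗ F n ⊗ K n M ⊗ s
    each zero rewrite F0≡0 = solve 5 (λ a r r′ k s → a :* con 0 :* r := con 0 :* r′ :+ a :* con 0 :* k :* s) refl (u 0) (row 0) (row′ 0) (K 0 M) s
    each (suc n) = begin
      a ⊗ f ⊗ row (suc n)                          ≡⟨ solve 3 (λ a f r → a :* f :* r := f :* (a :* r)) refl a f (row (suc n)) ⟩
      f ⊗ (a ⊗ row (suc n))                        ≡⟨ cong (f ⊗_) (transport-row G n M) ⟩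
      f ⊗ (row′ (suc n) ⊕ a ⊗ k ⊗ s)               ≡⟨ solve 5 (λ f r a k s → f :* (r :+ a :* k :* s) := f :* r :+ a :* f :* k :* s) refl f (row′ (suc n)) a k s ⟩
      f ⊗ row′ (suc n) ⊕ a ⊗ f ⊗ k ⊗ s ∎
      where
      a = u (suc n)
      f = F (suc n)
      k = K (suc n) M

-- Positivity and size of dual numbers.

-- Additive, and on nonnegative dual numbers submultiplicative and above both components, so one
-- rational bound controls value and derivative.
‖_‖ : Dual → ℚ
‖ a +ε a′ ‖ = a + a′

0≤ᴰ_ : Dual → Set
0≤ᴰ (a +ε a′) = 0ℚ ≤ a × 0ℚ ≤ a′

0≤ᴰ-⊕ : ∀ {x y} → 0≤ᴰ x → 0≤ᴰ y → 0≤ᴰ (x ⊕ y)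
0≤ᴰ-⊕ (p , p′) (q , q′) = 0≤+ p q , 0≤+ p′ q′

0≤ᴰ-⊗ : ∀ {x y} → 0≤ᴰ x → 0≤ᴰ y → 0≤ᴰ (x ⊗ y)
0≤ᴰ-⊗ (p , p′) (q , q′) = 0≤* p q , 0≤+ (0≤* p q′) (0≤* p′ q)

0≤ᴰ-∑ : ∀ {f} → (∀ n → 0≤ᴰ f n) → ∀ n → 0≤ᴰ ∑ n f
0≤ᴰ-∑ 0≤f zero    = ≤-refl , ≤-refl
0≤ᴰ-∑ 0≤f (suc n) = 0≤ᴰ-⊕ (0≤ᴰ-∑ 0≤f n) (0≤f n)

0≤‖‖ : ∀ {x} → 0≤ᴰ x → 0ℚ ≤ ‖ x ‖
0≤‖‖ (p , p′) = 0≤+ p p′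

du≤‖‖ : ∀ {x} → 0≤ᴰ x → du x ≤ ‖ x ‖
du≤‖‖ (p , _) = p≤q+p p

re≤‖‖ : ∀ {x} → 0≤ᴰ x → re x ≤ ‖ x ‖
re≤‖‖ (_ , p) = p≤p+q p

‖‖-⊕ : ∀ x y → ‖ x ⊕ y ‖ ≡ ‖ x ‖ + ‖ y ‖
‖‖-⊕ (a +ε a′) (b +ε b′) = solve 4 (λ a a′ b b′ → (a :+ b) :+ (a′ :+ b′) := (a :+ a′) :+ (b :+ b′)) refl a a′ b b′
  where open +-*-Solver

‖‖-⊗-≤ : ∀ {x y} → 0≤ᴰ x → 0≤ᴰ y → ‖ x ⊗ y ‖ ≤ ‖ x ‖ * ‖ y ‖
‖‖-⊗-≤ {a +ε a′} {b +ε b′} (_ , p′) (_ , q′) = subst (‖ (a +ε a′) ⊗ (b +ε b′) ‖ ≤_)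
  (solve 4 (λ a a′ b b′ → a :* b :+ (a :* b′ :+ a′ :* b) :+ a′ :* b′ := (a :+ a′) :* (b :+ b′)) refl a a′ b b′)
  (p≤p+q (0≤* p′ q′))
  where open +-*-Solver

‖∑‖-≤ : ∀ {f h} c n → (∀ i → i ℕ.< n → ‖ f i ‖ ≤ c * ‖ h i ‖) → ‖ ∑ n f ‖ ≤ c * ‖ ∑ n h ‖
‖∑‖-≤ c zero f≤h = ≤-reflexive (sym (*-zeroʳ c))
‖∑‖-≤ {f} {h} c (suc n) f≤h = subst₂ _≤_ (sym (‖‖-⊕ (∑ n f) (f n)))
  (trans (sym (*-distribˡ-+ c ‖ ∑ n h ‖ ‖ h n ‖)) (cong (c *_) (sym (‖‖-⊕ (∑ n h) (h n)))))
  (+-mono-≤ (‖∑‖-≤ c n (λ i i<n → f≤h i (ℕ.m≤n⇒m≤1+n i<n))) (f≤h n ℕ.≤-refl))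

-- Nested sums and their growth.

δ₀ : ℕ → Dual
δ₀ zero    = 1ᴰ
δ₀ (suc _) = 0ᴰ

-- A nested sum with its largest index fixed: for j ≥ 1 and n ≥ 1, w(n) times the sum of w(n₂) ⋯
-- w(n_j) over n > n₂ > ⋯ > n_j ≥ 1. The seed at 0 makes the empty inner sum 1.
chain : (ℕ → Dual) → ℕ → ℕ → Dual
chain w zero    n = δ₀ n
chain w (suc j) n = w n ⊗ ∑ n (chain w j)

scale : (ℕ → Dual) → ℕ → (ℕ → Dual) → ℕ → Dual
scale w zero    F n = F n
scale w (suc i) F n = w n ⊗ scale w i F n

∑-δ₀ : ∀ (f : ℕ → Dual) M → ∑ (suc M) (λ m → f m ⊗ δ₀ m) ≡ f 0
∑-δ₀ f zero    = trans (⊕⊗.+-identityˡ _) (⊕⊗.*-identityʳ (f 0))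
∑-δ₀ f (suc M) = trans (cong₂ _⊕_ (∑-δ₀ f M) (⊕⊗.zeroʳ (f (suc M)))) (⊕⊗.+-identityʳ (f 0))

Λ^-mono : ∀ j {n M} → n ℕ.≤ M → Λ n ^ j ≤ Λ M ^ j
Λ^-mono j n≤M = go (ℕ.≤⇒≤′ n≤M)
  where
  go : ∀ {n M} → n ℕ.≤′ M → Λ n ^ j ≤ Λ M ^ j
  go (ℕ.≤′-reflexive refl) = ≤-refl
  go (ℕ.≤′-step {n = M} p) = ≤-trans (go p) (^-mono j (0≤Λ M) (Λ-suc-≤ M))

∑-chain-zero : ∀ w M → ∑ (suc M) (chain w 0) ≡ 1ᴰ
∑-chain-zero w M = trans (∑-cong {chain w 0} {λ n → 1ᴰ ⊗ δ₀ n} (λ n → sym (⊕⊗.*-identityˡ (δ₀ n))) (suc M)) (∑-δ₀ (λ _ → 1ᴰ) M)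

record Weight (w : ℕ → Dual) : Set where
  field
    nonneg  : ∀ n → 0≤ᴰ w n
    bounded : ∀ n → ‖ w n ‖ ≤ ℕ→ℚ 2 * inv n

  ‖w‖≤Λ : ∀ n M → ‖ w n ‖ ≤ Λ M
  ‖w‖≤Λ n M = ≤-trans (bounded n) (≤-trans (*-monoˡ (0≤ℕ→ℚ 2) (inv≤1 n)) (2≤Λ M))

  0≤chain : ∀ j n → 0≤ᴰ chain w j n
  0≤chain zero    zero    = 0≤1 , ≤-refl
  0≤chain zero    (suc n) = ≤-refl , ≤-refl
  0≤chain (suc j) n       = 0≤ᴰ-⊗ (nonneg n) (0≤ᴰ-∑ (0≤chain j) n)

  chain-0 : ∀ j → chain w (suc j) 0 ≡ 0ᴰ
  chain-0 j = ⊕⊗.zeroʳ (w 0)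

  -- Inside one level the inner sums are bounded by their size at the final M, so the outer sum only
  -- adds up 2/n and the level costs 2 H_M ≤ `Λ M`.
  ‖∑chain‖≤ : ∀ j M → ‖ ∑ (suc M) (chain w j) ‖ ≤ Λ M ^ j
  ‖∑chain‖≤ zero M = ≤-reflexive (cong ‖_‖ (∑-chain-zero w M))
  ‖∑chain‖≤ (suc j) M = ≤-trans (go M ℕ.≤-refl) (*-monoʳ (0≤Λ^ M j) (*-monoˡ (0≤ℕ→ℚ 2) (p≤q+p {H M} {1ℚ} 0≤1)))
    where
    open ≤-Reasoning
    open +-*-Solver
    B = Λ M ^ j
    go : ∀ N → N ℕ.≤ M → ‖ ∑ (suc N) (chain w (suc j)) ‖ ≤ ℕ→ℚ 2 * H N * B
    go zero    _   = ≤-reflexive (trans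
      (cong ‖_‖ (trans (⊕⊗.+-identityˡ (chain w (suc j) 0)) (chain-0 j)))
      (sym (*-zeroˡ B)))
    go (suc N) N<M = begin
      ‖ ∑ (suc N) (chain w (suc j)) ⊕ x ⊗ s ‖       ≡⟨ ‖‖-⊕ (∑ (suc N) (chain w (suc j))) (x ⊗ s) ⟩
      ‖ ∑ (suc N) (chain w (suc j)) ‖ + ‖ x ⊗ s ‖   ≤⟨ +-mono-≤ (go N (ℕ.<⇒≤ N<M)) (≤-trans (‖‖-⊗-≤ (nonneg (suc N)) 0≤s)
        (*-mono-≤ (0≤‖‖ (nonneg (suc N))) (bounded (suc N)) (0≤‖‖ 0≤s) (≤-trans (‖∑chain‖≤ j N) (Λ^-mono j (ℕ.<⇒≤ N<M))))) ⟩
      ℕ→ℚ 2 * H N * B + ℕ→ℚ 2 * inv (suc N) * B ≡⟨ solve 3 (λ h i b → con (ℕ→ℚ 2) :* h :* b :+ con (ℕ→ℚ 2) :* i :* b := con (ℕ→ℚ 2) :* (h :+ i) :* b) refl (H N) (inv (suc N)) B ⟩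
      ℕ→ℚ 2 * H (suc N) * B ∎
      where
      x = w (suc N)
      s = ∑ (suc N) (chain w j)
      0≤s = 0≤ᴰ-∑ (0≤chain j) (suc N)

  0≤scale : ∀ {F} i → (∀ n → 0≤ᴰ F n) → ∀ n → 0≤ᴰ scale w i F n
  0≤scale zero    0≤F n = 0≤F n
  0≤scale (suc i) 0≤F n = 0≤ᴰ-⊗ (nonneg n) (0≤scale i 0≤F n)

  scale-0 : ∀ {F} i → F 0 ≡ 0ᴰ → scale w i F 0 ≡ 0ᴰ
  scale-0 zero    F0≡0 = F0≡0
  scale-0 (suc i) F0≡0 = trans (cong (w 0 ⊗_) (scale-0 i F0≡0)) (⊕⊗.zeroʳ (w 0))

  ‖∑scale‖≤ : ∀ {F} i → (∀ n → 0≤ᴰ F n) → ∀ M → ‖ ∑ (suc M) (scale w i F) ‖ ≤ Λ M ^ i * ‖ ∑ (suc M) F ‖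
  ‖∑scale‖≤ {F} zero    0≤F M = ≤-reflexive (sym (*-identityˡ ‖ ∑ (suc M) F ‖))
  ‖∑scale‖≤ {F} (suc i) 0≤F M = begin
    ‖ ∑ (suc M) (scale w (suc i) F) ‖     ≤⟨ ‖∑‖-≤ (Λ M) (suc M) (λ n _ → ≤-trans (‖‖-⊗-≤ (nonneg n) (0≤scale i 0≤F n)) (*-monoʳ (0≤‖‖ (0≤scale i 0≤F n)) (‖w‖≤Λ n M))) ⟩
    Λ M * ‖ ∑ (suc M) (scale w i F) ‖     ≤⟨ *-monoˡ (0≤Λ M) (‖∑scale‖≤ i 0≤F M) ⟩
    Λ M * (Λ M ^ i * ‖ ∑ (suc M) F ‖)     ≡⟨ *-assoc (Λ M) (Λ M ^ i) ‖ ∑ (suc M) F ‖ ⟨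
    Λ M ^ suc i * ‖ ∑ (suc M) F ‖ ∎
    where open ≤-Reasoning

open Weight

-- Moving factors in the limit.

-- Shaped for the boundary terms: the square truncation meets only n ≤ M, and row 0, which does not
-- decay for the kernel below or its transpose, is met only through a sequence vanishing at 0.
record Decays (K : Kernel) : Set where
  field
    nonneg  : ∀ n m → 0≤ᴰ K n m
    bounded : ∀ n M → suc n ℕ.≤ M → ‖ K (suc n) M ‖ ≤ Λ M * inv (suc M)

module _ {u v : ℕ → Dual} {K : Kernel} (U : Weight u) (V : Weight v) (tr : Transports u v K) (D : Decays K) where

  -- The boundary term is nonnegative and collects `Λ` / (M+1) from the kernel, `Λ` from the factor
  -- u, `Λ ^ a` from F and `Λ ^ j` from the chain; hence the exponent a + 2 + j.
  transport-limit : ∀ {F a} j → F 0 ≡ 0ᴰ → (∀ n → 0≤ᴰ F n) → (∀ M → ‖ ∑ (suc M) F ‖ ≤ Λ M ^ a) →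
    SameLimit (λ M → du (pair K (λ n → u n ⊗ F n) (chain v j) M)) (λ M → du (pair K F (chain v (suc j)) M))
  transport-limit {F} {a} j F0≡0 0≤F F≤ = SameLimit-+
    (λ M → cong du (transport {u} {v} {K} tr F (chain v j) M F0≡0))
    (λ M → proj₂ (0≤err M))
    (λ M → ≤-trans (du≤‖‖ (0≤err M)) (err≤ M))
    (Null-Λ^/ (suc (suc a) ℕ.+ j))
    where
    open ≤-Reasoning
    open +-*-Solver
    uF : ℕ → Dual
    uF n = u n ⊗ F n
    0≤uF : ∀ n → 0≤ᴰ uF n
    0≤uF n = 0≤ᴰ-⊗ (nonneg U n) (0≤F n)
    boundary err : ℕ → Dual
    boundary M = ∑ (suc M) (λ n → uF n ⊗ K n M)
    err M = boundary M ⊗ ∑ (suc M) (chain v j)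
    0≤boundary : ∀ M → 0≤ᴰ boundary M
    0≤boundary M = 0≤ᴰ-∑ (λ n → 0≤ᴰ-⊗ (0≤uF n) (Decays.nonneg D n M)) (suc M)
    0≤err : ∀ M → 0≤ᴰ err M
    0≤err M = 0≤ᴰ-⊗ (0≤boundary M) (0≤ᴰ-∑ (0≤chain V j) (suc M))
    uF0≡0 : uF 0 ≡ 0ᴰ
    uF0≡0 = trans (cong (u 0 ⊗_) F0≡0) (⊕⊗.zeroʳ (u 0))
    term≤ : ∀ M n → n ℕ.< suc M → ‖ uF n ⊗ K n M ‖ ≤ Λ M * inv (suc M) * ‖ uF n ‖
    term≤ M zero    _ = ≤-reflexive (trans
      (cong ‖_‖ (trans (cong (_⊗ K 0 M) uF0≡0) (⊕⊗.zeroˡ (K 0 M))))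
      (sym (trans (cong (λ x → Λ M * inv (suc M) * ‖ x ‖) uF0≡0) (*-zeroʳ (Λ M * inv (suc M))))))
    term≤ M (suc n) (ℕ.s≤s n<M) = begin
      ‖ uF (suc n) ⊗ K (suc n) M ‖       ≤⟨ ‖‖-⊗-≤ (0≤uF (suc n)) (Decays.nonneg D (suc n) M) ⟩
      ‖ uF (suc n) ‖ * ‖ K (suc n) M ‖   ≤⟨ *-monoˡ (0≤‖‖ (0≤uF (suc n))) (Decays.bounded D n M n<M) ⟩
      ‖ uF (suc n) ‖ * (Λ M * inv (suc M)) ≡⟨ *-comm ‖ uF (suc n) ‖ _ ⟩
      Λ M * inv (suc M) * ‖ uF (suc n) ‖ ∎
    err≤ : ∀ M → ‖ err M ‖ ≤ Λ M ^ (suc (suc a) ℕ.+ j) * inv (suc M)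
    err≤ M = begin
      ‖ err M ‖                                       ≤⟨ ‖‖-⊗-≤ (0≤boundary M) (0≤ᴰ-∑ (0≤chain V j) (suc M)) ⟩
      ‖ boundary M ‖ * ‖ ∑ (suc M) (chain v j) ‖      ≤⟨ *-mono-≤ (0≤‖‖ (0≤boundary M)) boundary≤ (0≤‖‖ (0≤ᴰ-∑ (0≤chain V j) (suc M))) (‖∑chain‖≤ V j M) ⟩
      L * x * (L ^ 1 * L ^ a) * L ^ j                 ≡⟨ solve 4 (λ L x A J → L :* x :* (L :* con 1ℚ :* A) :* J := (L :* (L :* A)) :* J :* x) refl L x (L ^ a) (L ^ j) ⟩
      L ^ suc (suc a) * L ^ j * x                     ≡⟨ cong (_* x) (^-homo-* L (suc (suc a)) j) ⟨
      L ^ (suc (suc a) ℕ.+ j) * x ∎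
      where
      L = Λ M
      x = inv (suc M)
      boundary≤ : ‖ boundary M ‖ ≤ L * x * (L ^ 1 * L ^ a)
      boundary≤ = ≤-trans (‖∑‖-≤ {h = uF} (L * x) (suc M) (term≤ M))
        (*-monoˡ (0≤* (0≤Λ M) (0≤inv (suc M))) (≤-trans (‖∑scale‖≤ U {F} 1 0≤F M) (*-monoˡ (0≤Λ^ M 1) (F≤ M))))

  transport-scale : ∀ {F a} i j → F 0 ≡ 0ᴰ → (∀ n → 0≤ᴰ F n) → (∀ M → ‖ ∑ (suc M) F ‖ ≤ Λ M ^ a) →
    SameLimit (λ M → du (pair K (scale u i F) (chain v j) M)) (λ M → du (pair K F (chain v (j ℕ.+ i)) M))
  transport-scale {F} {a} zero    j F0≡0 0≤F F≤ rewrite ℕ.+-identityʳ j = SameLimit-refl {λ M → du (pair K F (chain v j) M)}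
  transport-scale {F} {a} (suc i) j F0≡0 0≤F F≤ rewrite ℕ.+-suc j i =
    SameLimit-trans {λ M → du (pair K (scale u (suc i) F) (chain v j) M)} {λ M → du (pair K (scale u i F) (chain v (suc j)) M)}
                    {λ M → du (pair K F (chain v (suc (j ℕ.+ i))) M)}
      (transport-limit {scale u i F} {i ℕ.+ a} j (scale-0 U i F0≡0) (0≤scale U i 0≤F)
        (λ M → subst (‖ ∑ (suc M) (scale u i F) ‖ ≤_) (sym (^-homo-* (Λ M) i a)) (≤-trans (‖∑scale‖≤ U i 0≤F M) (*-monoˡ (0≤Λ^ M i) (F≤ M)))))
      (transport-scale {F} {a} i (suc j) F0≡0 0≤F F≤)

-- The shifted kernel.

-- y n is n + x; u n, v n are 1/n and 1/(n + x), extended by 0 at n = 0.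
real : ℚ → Dual
real a = a +ε 0ℚ

u v y : ℕ → Dual
u n = real (inv n)
v n = inv n +ε inv n * inv n
y n = ℕ→ℚ n +ε - 1ℚ

-- The Gamma quotient as a finite product: n! Γ(m+1+x) / Γ(n+m+1+x) is the product of j/(j+m+x) over
-- 1 ≤ j ≤ n.
K : Kernel
K zero    m = 1ᴰ
K (suc n) m = K n m ⊗ (real (ℕ→ℚ (suc n)) ⊗ v (suc n ℕ.+ m))

real-u : ∀ n → real (ℕ→ℚ (suc n)) ⊗ u (suc n) ≡ 1ᴰ
real-u n = cong₂ _+ε_ (inv-inverse n)
  (solve 2 (λ s x → s :* con 0ℚ :+ con 0ℚ :* x := con 0ℚ) refl (ℕ→ℚ (suc n)) (inv (suc n)))
  where open +-*-Solver

v-y : ∀ n → v (suc n) ⊗ y (suc n) ≡ 1ᴰ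
v-y n = cong₂ _+ε_ (trans (*-comm x s) (inv-inverse n)) (begin
  x * - 1ℚ + x * x * s   ≡⟨ solve 2 (λ x s → x :* (:- con 1ℚ) :+ x :* x :* s := x :* (s :* x :- con 1ℚ)) refl x s ⟩
  x * (s * x - 1ℚ)       ≡⟨ cong (λ q → x * (q - 1ℚ)) (inv-inverse n) ⟩
  x * 0ℚ                 ≡⟨ *-zeroʳ x ⟩
  0ℚ ∎)
  where
  open ≡-Reasoning
  open +-*-Solver
  x = inv (suc n)
  s = ℕ→ℚ (suc n)

y-+ : ∀ n m → y (n ℕ.+ m) ≡ real (ℕ→ℚ n) ⊕ y m
y-+ n m = cong₂ _+ε_ (ℕ→ℚ-homo-+ n m) (sym (+-identityˡ (- 1ℚ)))

K-suc-y : ∀ n m → K (suc n) m ⊗ y (suc n ℕ.+ m) ≡ real (ℕ→ℚ (suc n)) ⊗ K n m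
K-suc-y n m = begin
  K n m ⊗ (s ⊗ v l) ⊗ y l   ≡⟨ solve 4 (λ k s v y → k :* (s :* v) :* y := s :* k :* (v :* y)) refl (K n m) s (v l) (y l) ⟩
  s ⊗ K n m ⊗ (v l ⊗ y l)   ≡⟨ cong (s ⊗ K n m ⊗_) (v-y (n ℕ.+ m)) ⟩
  s ⊗ K n m ⊗ 1ᴰ            ≡⟨ ⊕⊗.*-identityʳ (s ⊗ K n m) ⟩
  s ⊗ K n m ∎
  where
  open ≡-Reasoning
  open ⊕⊗-Solver
  s = real (ℕ→ℚ (suc n))
  l = suc n ℕ.+ m

-- The recurrence in m. The product runs over n, so this is an induction on n: passing from m to m +
-- 1 shifts every denominator, and the quotient telescopes.
K-y : ∀ n m → K n (suc m) ⊗ y (n ℕ.+ suc m) ≡ K n m ⊗ y (suc m)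
K-y zero    m = refl
K-y (suc n) m = begin
  K (suc n) (suc m) ⊗ y (suc n ℕ.+ suc m)   ≡⟨ K-suc-y n (suc m) ⟩
  s ⊗ k                                     ≡⟨ ⊕⊗.*-identityʳ (s ⊗ k) ⟨
  s ⊗ k ⊗ 1ᴰ                                ≡⟨ cong (s ⊗ k ⊗_) (v-y (n ℕ.+ m)) ⟨
  s ⊗ k ⊗ (v l ⊗ y l)                       ≡⟨ solve 4 (λ s k v y → s :* k :* (v :* y) := s :* v :* (k :* y)) refl s k (v l) (y l) ⟩
  s ⊗ v l ⊗ (k ⊗ y l)                       ≡⟨ cong (λ i → s ⊗ v l ⊗ (k ⊗ y i)) (ℕ.+-suc n m) ⟨
  s ⊗ v l ⊗ (k ⊗ y (n ℕ.+ suc m))           ≡⟨ cong (s ⊗ v l ⊗_) (K-y n m) ⟩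
  s ⊗ v l ⊗ (K n m ⊗ y (suc m))             ≡⟨ solve 4 (λ s v k y → s :* v :* (k :* y) := k :* (s :* v) :* y) refl s (v l) (K n m) (y (suc m)) ⟩
  K (suc n) m ⊗ y (suc m) ∎
  where
  open ≡-Reasoning
  open ⊕⊗-Solver
  s = real (ℕ→ℚ (suc n))
  l = suc n ℕ.+ m
  k = K n (suc m)

-- 1/n + 1/(m+x) = (n+m+x) / (n (m+x))
u⊕v : ∀ n m k → u (suc n) ⊗ k ⊕ v (suc m) ⊗ k ≡ k ⊗ y (suc n ℕ.+ suc m) ⊗ (u (suc n) ⊗ v (suc m))
u⊕v n m k = begin
  a ⊗ k ⊕ b ⊗ k                                   ≡⟨ solve 3 (λ a b k → a :* k :+ b :* k := a :* k :* con 1 :+ b :* k :* con 1) refl a b k ⟩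
  a ⊗ k ⊗ 1ᴰ ⊕ b ⊗ k ⊗ 1ᴰ                         ≡⟨ cong₂ (λ p q → a ⊗ k ⊗ p ⊕ b ⊗ k ⊗ q) (v-y m) (real-u n) ⟨
  a ⊗ k ⊗ (b ⊗ y (suc m)) ⊕ b ⊗ k ⊗ (s ⊗ a)       ≡⟨ solve 5 (λ a b k y s → a :* k :* (b :* y) :+ b :* k :* (s :* a) := k :* (s :+ y) :* (a :* b)) refl a b k (y (suc m)) s ⟩
  k ⊗ (s ⊕ y (suc m)) ⊗ (a ⊗ b)                   ≡⟨ cong (λ q → k ⊗ q ⊗ (a ⊗ b)) (y-+ (suc n) (suc m)) ⟨
  k ⊗ y (suc n ℕ.+ suc m) ⊗ (a ⊗ b) ∎
  where
  open ≡-Reasoning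
  open ⊕⊗-Solver
  a = u (suc n)
  b = v (suc m)
  s = real (ℕ→ℚ (suc n))

-- By partial fractions 1/n + 1/(m+x) supplies the factor n+m+x, which the recurrence in m absorbs,
-- leaving m+x to cancel `v`. The transposed relation uses the recurrence in n instead.
K-transports : Transports u v K
K-transports n m = sym (begin
  a ⊗ k ⊕ b ⊗ k                          ≡⟨ u⊕v n m k ⟩
  k ⊗ y (suc n ℕ.+ suc m) ⊗ (a ⊗ b)      ≡⟨ cong (_⊗ (a ⊗ b)) (K-y (suc n) m) ⟩
  K (suc n) m ⊗ y (suc m) ⊗ (a ⊗ b)      ≡⟨ solve 4 (λ k y a b → k :* y :* (a :* b) := a :* k :* (b :* y)) refl (K (suc n) m) (y (suc m)) a b ⟩
  a ⊗ K (suc n) m ⊗ (b ⊗ y (suc m))      ≡⟨ cong (a ⊗ K (suc n) m ⊗_) (v-y m) ⟩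
  a ⊗ K (suc n) m ⊗ 1ᴰ                   ≡⟨ ⊕⊗.*-identityʳ (a ⊗ K (suc n) m) ⟩
  a ⊗ K (suc n) m ∎)
  where
  open ≡-Reasoning
  open ⊕⊗-Solver
  a = u (suc n)
  b = v (suc m)
  k = K (suc n) (suc m)

Kᵀ-transports : Transports v u (K ᵀ)
Kᵀ-transports m n = sym (begin
  b ⊗ k ⊕ a ⊗ k                          ≡⟨ ⊕⊗.+-comm (b ⊗ k) (a ⊗ k) ⟩
  a ⊗ k ⊕ b ⊗ k                          ≡⟨ u⊕v n m k ⟩
  k ⊗ y (suc n ℕ.+ suc m) ⊗ (a ⊗ b)      ≡⟨ cong (_⊗ (a ⊗ b)) (K-suc-y n (suc m)) ⟩
  s ⊗ K n (suc m) ⊗ (a ⊗ b)              ≡⟨ solve 4 (λ s k a b → s :* k :* (a :* b) := b :* k :* (s :* a)) refl s (K n (suc m)) a b ⟩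
  b ⊗ K n (suc m) ⊗ (s ⊗ a)              ≡⟨ cong (b ⊗ K n (suc m) ⊗_) (real-u n) ⟩
  b ⊗ K n (suc m) ⊗ 1ᴰ                   ≡⟨ ⊕⊗.*-identityʳ (b ⊗ K n (suc m)) ⟩
  b ⊗ K n (suc m) ∎)
  where
  open ≡-Reasoning
  open ⊕⊗-Solver
  a = u (suc n)
  b = v (suc m)
  k = K (suc n) (suc m)
  s = real (ℕ→ℚ (suc n))

u-weight : Weight u
u-weight = record
  { nonneg  = λ n → 0≤inv n , ≤-refl
  ; bounded = λ n → subst (inv n + 0ℚ ≤_) (solve 1 (λ x → x :+ x := con (ℕ→ℚ 2) :* x) refl (inv n)) (+-monoʳ-≤ (inv n) (0≤inv n))
  }
  where open +-*-Solver

v-weight : Weight v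
v-weight = record
  { nonneg  = λ n → 0≤inv n , 0≤* (0≤inv n) (0≤inv n)
  ; bounded = λ n → subst (inv n + inv n * inv n ≤_) (solve 1 (λ x → x :+ x :* con 1ℚ := con (ℕ→ℚ 2) :* x) refl (inv n))
                       (+-monoʳ-≤ (inv n) (*-monoˡ (0≤inv n) (inv≤1 n)))
  }
  where open +-*-Solver

0≤K : ∀ n m → 0≤ᴰ K n m
0≤K zero    m = 0≤1 , ≤-refl
0≤K (suc n) m = 0≤ᴰ-⊗ (0≤K n m) (0≤ᴰ-⊗ (0≤ℕ→ℚ (suc n) , ≤-refl) (nonneg v-weight (suc n ℕ.+ m)))

-- The logarithmic derivative: each factor j/(j+m+x) contributes 1/(j+m) ≤ 1/j.
du-K≤ : ∀ n m → du (K n m) ≤ re (K n m) * H n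
du-K≤ zero    m = ≤-refl
du-K≤ (suc n) m = begin
  c * (s * (x * x) + 0ℚ * x) + e * (s * x)     ≤⟨ +-monoʳ-≤ (c * (s * (x * x) + 0ℚ * x)) (*-monoʳ 0≤sx (du-K≤ n m)) ⟩
  c * (s * (x * x) + 0ℚ * x) + c * H n * (s * x) ≡⟨ solve 4 (λ c s x h → c :* (s :* (x :* x) :+ con 0ℚ :* x) :+ c :* h :* (s :* x) := c :* (s :* x) :* (h :+ x)) refl c s x (H n) ⟩
  c * (s * x) * (H n + x)                      ≤⟨ *-monoˡ (0≤* (proj₁ (0≤K n m)) 0≤sx) (+-monoʳ-≤ (H n) (inv-anti (ℕ.m≤m+n n m))) ⟩
  c * (s * x) * H (suc n) ∎
  where
  open ≤-Reasoning
  open +-*-Solver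
  c = re (K n m)
  e = du (K n m)
  s = ℕ→ℚ (suc n)
  x = inv (suc n ℕ.+ m)
  0≤sx : 0ℚ ≤ s * x
  0≤sx = 0≤* (0≤ℕ→ℚ (suc n)) (0≤inv (suc n ℕ.+ m))

-- At x = 0 the factor with j = 1 is 1/(m+1), and the others are at most 1.
re-K≤ : ∀ n m → re (K (suc n) m) ≤ inv (suc m)
re-K≤ zero    m = ≤-reflexive (trans (*-identityˡ _) (*-identityˡ _))
re-K≤ (suc n) m = begin
  re (K (suc n) m) * (s * x) ≤⟨ *-mono-≤ (proj₁ (0≤K (suc n) m)) (re-K≤ n m) (0≤* (0≤ℕ→ℚ (2 ℕ.+ n)) (0≤inv (2 ℕ.+ n ℕ.+ m)))
                                 (*-monoˡ (0≤ℕ→ℚ (2 ℕ.+ n)) (inv-anti (ℕ.m≤m+n (suc n) m))) ⟩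
  inv (suc m) * (s * inv (2 ℕ.+ n)) ≡⟨ cong (inv (suc m) *_) (inv-inverse (suc n)) ⟩
  inv (suc m) * 1ℚ                  ≡⟨ *-identityʳ (inv (suc m)) ⟩
  inv (suc m) ∎
  where
  open ≤-Reasoning
  s = ℕ→ℚ (2 ℕ.+ n)
  x = inv (2 ℕ.+ n ℕ.+ m)

-- At x = 0 each factor is at most j/(j+1), and these telescope.
re-Kᵀ≤ : ∀ n m → re (K n (suc m)) ≤ inv (suc n)
re-Kᵀ≤ zero    m = ≤-refl
re-Kᵀ≤ (suc n) m = begin
  re (K n (suc m)) * (s * x)       ≤⟨ *-mono-≤ (proj₁ (0≤K n (suc m))) (re-Kᵀ≤ n m) (0≤* (0≤ℕ→ℚ (suc n)) (0≤inv (suc n ℕ.+ suc m)))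
                                       (*-monoˡ (0≤ℕ→ℚ (suc n)) (inv-anti (ℕ.≤-trans (ℕ.m≤m+n (suc n) m) (ℕ.≤-reflexive (sym (ℕ.+-suc n m)))))) ⟩
  inv (suc n) * (s * inv (2 ℕ.+ n)) ≡⟨ solve 3 (λ i s j → i :* (s :* j) := (s :* i) :* j) refl (inv (suc n)) s (inv (2 ℕ.+ n)) ⟩
  s * inv (suc n) * inv (2 ℕ.+ n)   ≡⟨ cong (_* inv (2 ℕ.+ n)) (inv-inverse n) ⟩
  1ℚ * inv (2 ℕ.+ n)                ≡⟨ *-identityˡ (inv (2 ℕ.+ n)) ⟩
  inv (2 ℕ.+ n) ∎
  where
  open ≤-Reasoning
  open +-*-Solver
  s = ℕ→ℚ (suc n)
  x = inv (suc n ℕ.+ suc m)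

‖K‖≤ : ∀ n m M → n ℕ.≤ M → re (K n m) ≤ inv (suc M) → ‖ K n m ‖ ≤ Λ M * inv (suc M)
‖K‖≤ n m M n≤M re≤ = begin
  c + du (K n m)              ≤⟨ +-monoʳ-≤ c (≤-trans (du-K≤ n m) (*-monoˡ 0≤c (sumTo-mono 0≤inv n≤M))) ⟩
  c + c * H M                 ≡⟨ solve 2 (λ c h → c :+ c :* h := (con 1ℚ :+ h) :* c) refl c (H M) ⟩
  (1ℚ + H M) * c              ≤⟨ *-mono-≤ (0≤+ 0≤1 (0≤H M)) (1+H≤Λ M) 0≤c re≤ ⟩
  Λ M * inv (suc M) ∎
  where
  open ≤-Reasoning
  open +-*-Solver
  c = re (K n m)
  0≤c = proj₁ (0≤K n m)

K-decays : Decays K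
K-decays = record
  { nonneg  = 0≤K
  ; bounded = λ n M n<M → ‖K‖≤ (suc n) M M n<M (re-K≤ n M)
  }

Kᵀ-decays : Decays (K ᵀ)
Kᵀ-decays = record
  { nonneg  = λ m n → 0≤K n m
  ; bounded = λ m M _ → ‖K‖≤ M (suc m) M ℕ.≤-refl (re-Kᵀ≤ M m)
  }

-- Both ends move to a common middle, the pairing of `chain u (suc p)` with `chain v (suc m)`: one
-- sends m + 1 factors `u` across `K`, the other p + 1 factors `v` across its transpose. Here `δ₀`
-- is the chain of length 0.
duality : ∀ p m → SameLimit (λ M → du (pair K (scale u (suc m) (chain u (suc p))) δ₀ M))
                            (λ M → du (pair (K ᵀ) (scale v (suc p) (chain v (suc m))) δ₀ M))
duality p m = SameLimit-trans {A₁} {B₁} {A₂}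
  (transport-scale u-weight v-weight K-transports K-decays {chain u (suc p)} {suc p} (suc m) 0
    (chain-0 u-weight p) (0≤chain u-weight (suc p)) (‖∑chain‖≤ u-weight (suc p)))
  (SameLimit-sym {A₂} {B₁} (SameLimit-≡ {A₂} {A₂} {B₂} {B₁} (λ _ → refl) (λ M → cong du (pair-ᵀ K (chain u (suc p)) (chain v (suc m)) M))
    (transport-scale v-weight u-weight Kᵀ-transports Kᵀ-decays {chain v (suc m)} {suc m} (suc p) 0
      (chain-0 v-weight m) (0≤chain v-weight (suc m)) (‖∑chain‖≤ v-weight (suc m)))))
  where
  A₁ A₂ B₁ B₂ : ℕ → ℚ
  A₁ M = du (pair K (scale u (suc m) (chain u (suc p))) δ₀ M)
  A₂ M = du (pair (K ᵀ) (scale v (suc p) (chain v (suc m))) δ₀ M)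
  B₁ M = du (pair K (chain u (suc p)) (chain v (suc m)) M)
  B₂ M = du (pair (K ᵀ) (chain v (suc m)) (chain u (suc p)) M)

-- Identifying both ends with the given partial sums.

sumTo-cong : ∀ {f h} → (∀ n → f (suc n) ≡ h (suc n)) → ∀ M → sumTo M f ≡ sumTo M h
sumTo-cong f≡h zero    = refl
sumTo-cong f≡h (suc M) = cong₂ _+_ (sumTo-cong f≡h M) (f≡h M)

sumTo-+ : ∀ f h M → sumTo M (λ n → f n + h n) ≡ sumTo M f + sumTo M h
sumTo-+ f h zero    = refl
sumTo-+ f h (suc M) = trans (cong (_+ (f (suc M) + h (suc M))) (sumTo-+ f h M))
  (solve 4 (λ a b c d → (a :+ b) :+ (c :+ d) := (a :+ c) :+ (b :+ d)) refl (sumTo M f) (sumTo M h) (f (suc M)) (h (suc M)))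
  where open +-*-Solver

sumTo-*ˡ : ∀ c f M → sumTo M (λ n → c * f n) ≡ c * sumTo M f
sumTo-*ˡ c f zero    = sym (*-zeroʳ c)
sumTo-*ˡ c f (suc M) = trans (cong (_+ c * f (suc M)) (sumTo-*ˡ c f M)) (sym (*-distribˡ-+ c (sumTo M f) (f (suc M))))

sumTo-0 : ∀ M → sumTo M (λ _ → 0ℚ) ≡ 0ℚ
sumTo-0 zero    = refl
sumTo-0 (suc M) = trans (+-identityʳ _) (sumTo-0 M)

sumTo-swap : ∀ (f : ℕ → ℕ → ℚ) M N → sumTo M (λ i → sumTo N (f i)) ≡ sumTo N (λ j → sumTo M (λ i → f i j))
sumTo-swap f zero    N = sym (sumTo-0 N)
sumTo-swap f (suc M) N = trans (cong (_+ sumTo N (f (suc M))) (sumTo-swap f M N)) (sym (sumTo-+ (λ j → sumTo M (λ i → f i j)) (f (suc M)) N))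

sumTo-head : ∀ f M → sumTo (suc M) f ≡ f 1 + sumTo M (λ n → f (suc n))
sumTo-head f zero    = trans (+-identityˡ (f 1)) (sym (+-identityʳ (f 1)))
sumTo-head f (suc M) = trans (cong (_+ f (suc (suc M))) (sumTo-head f M)) (+-assoc (f 1) (sumTo M (λ n → f (suc n))) (f (suc (suc M))))

∑-sumTo : ∀ f M → f 0 ≡ 0ᴰ → ∑ (suc M) f ≡ (sumTo M (λ n → re (f n)) +ε sumTo M (λ n → du (f n)))
∑-sumTo f zero    f0≡0 = trans (⊕⊗.+-identityˡ (f 0)) f0≡0
∑-sumTo f (suc M) f0≡0 = cong (_⊕ f (suc M)) (∑-sumTo f M f0≡0)

pair-δ₀ : ∀ K F M → pair K F δ₀ M ≡ ∑ (suc M) (λ n → F n ⊗ K n 0)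
pair-δ₀ K F M = ∑-cong {λ n → F n ⊗ ∑ (suc M) (λ m → K n m ⊗ δ₀ m)} {λ n → F n ⊗ K n 0} (λ n → cong (F n ⊗_) (∑-δ₀ (K n) M)) (suc M)

mutual
  -- The classical expression of s(n,p)/n! as 1/n times the sum of 1/(n₂ ⋯ n_p) over n > n₂ > ⋯ >
  -- n_p ≥ 1.
  chain-u : ∀ p n → chain u p n ≡ real (ℕ→ℚ (stirling n p) * inv (n !))
  chain-u zero    zero    = refl
  chain-u zero    (suc n) = cong real (sym (*-zeroˡ (inv (suc n !))))
  chain-u (suc p) zero    = refl
  chain-u (suc p) (suc n) = begin
    u (suc n) ⊗ ∑ (suc n) (chain u p)                  ≡⟨ cong (u (suc n) ⊗_) (∑-chain-u p n) ⟩
    u (suc n) ⊗ real (s * inv (n !))                   ≡⟨ cong₂ _+ε_ (solve 3 (λ x s i → x :* (s :* i) := s :* (x :* i)) refl (inv (suc n)) s (inv (n !)))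
                                                            (solve 2 (λ x a → x :* con 0ℚ :+ con 0ℚ :* a := con 0ℚ) refl (inv (suc n)) (s * inv (n !))) ⟩
    real (s * (inv (suc n) * inv (n !)))               ≡⟨ cong (λ q → real (s * q)) (inv-homo-* (suc n) (n !)) ⟨
    real (s * inv (suc n !)) ∎
    where
    open ≡-Reasoning
    open +-*-Solver
    s = ℕ→ℚ (stirling (suc n) (suc p))

  -- Adding one term is the Stirling recurrence divided by a factorial.
  ∑-chain-u : ∀ p n → ∑ (suc n) (chain u p) ≡ real (ℕ→ℚ (stirling (suc n) (suc p)) * inv (n !))
  ∑-chain-u p zero = trans (⊕⊗.+-identityˡ (chain u p 0)) (trans (chain-u p 0)
    (cong (λ k → real (ℕ→ℚ k * inv 1)) (sym (ℕ.+-identityʳ (stirling 0 p)))))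
  ∑-chain-u p (suc n) = begin
    ∑ (suc n) (chain u p) ⊕ chain u p (suc n)            ≡⟨ cong₂ _⊕_ (∑-chain-u p n) (chain-u p (suc n)) ⟩
    real (a * inv (n !)) ⊕ real (b * j)                  ≡⟨ cong₂ _+ε_ eq (+-identityˡ 0ℚ) ⟩
    real (ℕ→ℚ (stirling (2 ℕ.+ n) (suc p)) * j) ∎
    where
    open ≡-Reasoning
    open +-*-Solver
    a = ℕ→ℚ (stirling (suc n) (suc p))
    b = ℕ→ℚ (stirling (suc n) p)
    j = inv (suc n !)
    s = ℕ→ℚ (suc n)
    n!-cancel : inv (n !) ≡ s * j
    n!-cancel = begin
      inv (n !)                       ≡⟨ *-identityˡ _ ⟨
      1ℚ * inv (n !)                  ≡⟨ cong (_* inv (n !)) (inv-inverse n) ⟨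
      s * inv (suc n) * inv (n !)     ≡⟨ *-assoc s (inv (suc n)) (inv (n !)) ⟩
      s * (inv (suc n) * inv (n !))   ≡⟨ cong (s *_) (inv-homo-* (suc n) (n !)) ⟨
      s * j ∎
    eq : a * inv (n !) + b * j ≡ ℕ→ℚ (stirling (2 ℕ.+ n) (suc p)) * j
    eq = begin
      a * inv (n !) + b * j   ≡⟨ cong (λ q → a * q + b * j) n!-cancel ⟩
      a * (s * j) + b * j     ≡⟨ solve 4 (λ a s j b → a :* (s :* j) :+ b :* j := (b :+ s :* a) :* j) refl a s j b ⟩
      (b + s * a) * j         ≡⟨ cong (λ q → (b + q) * j) (ℕ→ℚ-homo-* (suc n) (stirling (suc n) (suc p))) ⟨
      (b + ℕ→ℚ (suc n ℕ.* stirling (suc n) (suc p))) * j ≡⟨ cong (_* j) (ℕ→ℚ-homo-+ (stirling (suc n) p) (suc n ℕ.* stirling (suc n) (suc p))) ⟨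
      ℕ→ℚ (stirling (2 ℕ.+ n) (suc p)) * j ∎

scale-chain-u : ∀ i p n → scale u i (chain u p) n ≡ real (ℕ→ℚ (stirling n p) * inv (n ! ℕ.* n ℕ.^ i))
scale-chain-u zero    p n = trans (chain-u p n) (cong (λ k → real (ℕ→ℚ (stirling n p) * inv k)) (sym (ℕ.*-identityʳ (n !))))
scale-chain-u (suc i) p n = trans (cong (u n ⊗_) (scale-chain-u i p n)) (cong₂ _+ε_ (begin
    inv n * (s * inv (n ! ℕ.* n ℕ.^ i))   ≡⟨ solve 3 (λ x s i → x :* (s :* i) := s :* (x :* i)) refl (inv n) s (inv (n ! ℕ.* n ℕ.^ i)) ⟩
    s * (inv n * inv (n ! ℕ.* n ℕ.^ i))   ≡⟨ cong (s *_) (inv-homo-* n (n ! ℕ.* n ℕ.^ i)) ⟨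
    s * inv (n ℕ.* (n ! ℕ.* n ℕ.^ i))     ≡⟨ cong (λ k → s * inv k) (trans (sym (ℕ.*-assoc n (n !) (n ℕ.^ i))) (trans (cong (ℕ._* n ℕ.^ i) (ℕ.*-comm n (n !))) (ℕ.*-assoc (n !) n (n ℕ.^ i)))) ⟩
    s * inv (n ! ℕ.* (n ℕ.* n ℕ.^ i)) ∎)
  (solve 2 (λ x a → x :* con 0ℚ :+ con 0ℚ :* a := con 0ℚ) refl (inv n) (s * inv (n ! ℕ.* n ℕ.^ i))))
  where
  open ≡-Reasoning
  open +-*-Solver
  s = ℕ→ℚ (stirling n p)

K-0 : ∀ n → K n 0 ≡ (1ℚ +ε H n)
K-0 zero    = refl
K-0 (suc n) = begin
  K n 0 ⊗ (real s ⊗ v (suc n ℕ.+ 0))   ≡⟨ cong₂ (λ k i → k ⊗ (real s ⊗ v i)) (K-0 n) (ℕ.+-identityʳ (suc n)) ⟩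
  (1ℚ +ε H n) ⊗ (real s ⊗ v (suc n))   ≡⟨ cong₂ _+ε_ (solve 1 (λ a → con 1ℚ :* a := a) refl (s * x))
                                            (solve 3 (λ h s x → con 1ℚ :* (s :* (x :* x) :+ con 0ℚ :* x) :+ h :* (s :* x) := (h :+ x) :* (s :* x)) refl (H n) s x) ⟩
  (s * x +ε (H n + x) * (s * x))       ≡⟨ cong (λ q → (q +ε (H n + x) * q)) (inv-inverse n) ⟩
  (1ℚ +ε (H n + x) * 1ℚ)               ≡⟨ cong (1ℚ +ε_) (*-identityʳ (H n + x)) ⟩
  (1ℚ +ε H (suc n)) ∎
  where
  open ≡-Reasoning
  open +-*-Solver
  s = ℕ→ℚ (suc n)
  x = inv (suc n)

lhs-pair : ∀ p m M → du (pair K (scale u (suc m) (chain u (suc p))) δ₀ M) ≡ lhsPartial (suc p) m M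
lhs-pair p m M = begin
  du (pair K F δ₀ M)                          ≡⟨ cong du (pair-δ₀ K F M) ⟩
  du (∑ (suc M) (λ n → F n ⊗ K n 0))          ≡⟨ cong du (∑-sumTo (λ n → F n ⊗ K n 0) M (trans (cong (_⊗ K 0 0) (scale-0 u-weight (suc m) (chain-0 u-weight p))) (⊕⊗.zeroˡ (K 0 0)))) ⟩
  sumTo M (λ n → du (F n ⊗ K n 0))            ≡⟨ sumTo-cong {λ n → du (F n ⊗ K n 0)} {λ n → H n * f n} (λ n → term (suc n)) M ⟩
  lhsPartial (suc p) m M ∎
  where
  open ≡-Reasoning
  open +-*-Solver
  F = scale u (suc m) (chain u (suc p))
  f : ℕ → ℚ
  f n = ℕ→ℚ (stirling n (suc p)) * inv (n ! ℕ.* n ℕ.^ suc m)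
  -- The u-side does not involve x, so only the kernel is differentiated.
  term : ∀ n → du (F n ⊗ K n 0) ≡ H n * f n
  term n = trans (cong du (cong₂ _⊗_ (scale-chain-u (suc m) (suc p) n) (K-0 n)))
    (solve 2 (λ f h → f :* h :+ con 0ℚ :* con 1ℚ := h :* f) refl (f n) (H n))

-- Minus the derivative of 1/(n_i + x) at 0 is 1/n_i², so the product rule turns the i-th argument 1
-- into 2, with i counted from 1.
insert2 : ℕ → ℕ → List ℕ
insert2 m i = ones (i ℕ.∸ 1) ++ (2 ∷ ones (m ℕ.∸ i))

-- −d/dx at 0 of the truncated ζ({1}_m) with every n_i replaced by n_i + x
dz : ℕ → ℕ → ℚ
dz m n = sumTo m (λ i → mzvT (insert2 m i) n)

sumTo-dz : ∀ s m M → sumTo M (λ n → inv (n ℕ.^ s) * dz m (n ℕ.∸ 1)) ≡ sumTo m (λ i → mzvT (s ∷ insert2 m i) M)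
sumTo-dz s m M = trans
  (sumTo-cong {λ n → inv (n ℕ.^ s) * dz m (n ℕ.∸ 1)} (λ n → sym (sumTo-*ˡ (inv (suc n ℕ.^ s)) (λ i → mzvT (insert2 m i) n) m)) M)
  (sumTo-swap (λ n i → inv (n ℕ.^ s) * mzvT (insert2 m i) (n ℕ.∸ 1)) M m)

dz-suc : ∀ m n → dz (suc m) n ≡ mzvT (2 ∷ ones m) n + sumTo n (λ k → inv (k ℕ.^ 1) * dz m (k ℕ.∸ 1))
dz-suc m n = trans (sumTo-head (λ i → mzvT (insert2 (suc m) i) n) m)
  (cong (λ q → mzvT (2 ∷ ones m) n + q) (trans
    -- `sumTo-cong` asks only about i ≥ 1, where i ∸ 1 computes and the two lists agree
    -- definitionally.
    (sumTo-cong {λ i → mzvT (insert2 (suc m) (suc i)) n} {λ i → mzvT (1 ∷ insert2 m i) n} (λ _ → refl) m)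
    (sym (sumTo-dz 1 m n))))

inv-^-suc : ∀ n k → inv (n ℕ.^ suc k) ≡ inv n * inv (n ℕ.^ k)
inv-^-suc n k = inv-homo-* n (n ℕ.^ k)

inv-^1 : ∀ n → inv (n ℕ.^ 1) ≡ inv n
inv-^1 n = cong inv (ℕ.*-identityʳ n)

-- The product rule on the outermost factor: differentiating it puts the 2 in front, differentiating
-- the rest is the induction hypothesis. This is the split of `dz-suc`.
∑-chain-v : ∀ m n → ∑ (suc n) (chain v m) ≡ (mzvT (ones m) n +ε dz m n)
∑-chain-v zero    n = ∑-chain-zero v n
∑-chain-v (suc m) n = trans (∑-sumTo (chain v (suc m)) n (chain-0 v-weight m)) (cong₂ _+ε_
  (sumTo-cong {λ k → re (chain v (suc m) k)} (λ k → cong₂ _*_ (sym (inv-^1 (suc k))) (cong re (∑-chain-v m k))) n)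
  (begin
    sumTo n (λ k → du (chain v (suc m) k))
      ≡⟨ sumTo-cong {λ k → du (chain v (suc m) k)} {λ k → a k + b k} term n ⟩
    sumTo n (λ k → a k + b k)
      ≡⟨ sumTo-+ a b n ⟩
    sumTo n a + sumTo n b
      ≡⟨ dz-suc m n ⟨
    dz (suc m) n ∎))
  where
  open ≡-Reasoning
  a b : ℕ → ℚ
  a k = inv (k ℕ.^ 2) * mzvT (ones m) (k ℕ.∸ 1)
  b k = inv (k ℕ.^ 1) * dz m (k ℕ.∸ 1)
  term : ∀ k → du (chain v (suc m) (suc k)) ≡ a (suc k) + b (suc k)
  term k = begin
    du (v (suc k) ⊗ ∑ (suc k) (chain v m))            ≡⟨ cong (λ q → du (v (suc k) ⊗ q)) (∑-chain-v m k) ⟩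
    x * dz m k + x * x * mzvT (ones m) k              ≡⟨ +-comm (x * dz m k) (x * x * mzvT (ones m) k) ⟩
    x * x * mzvT (ones m) k + x * dz m k              ≡⟨ cong₂ (λ p q → p * mzvT (ones m) k + q * dz m k)
                                                          (sym (trans (inv-^-suc (suc k) 1) (cong (x *_) (inv-^1 (suc k))))) (sym (inv-^1 (suc k))) ⟩
    a (suc k) + b (suc k) ∎
    where x = inv (suc k)

-- The dual number of (n+x)^(-p-1), one factor coming from the chain and p from `scale`; its
-- derivative is the origin of the coefficient p + 1 in the theorem.
scale-v : ∀ p (S : ℕ → Dual) n → scale v p (λ k → v k ⊗ S k) n
  ≡ (inv (n ℕ.^ suc p) +ε ℕ→ℚ (suc p) * inv (n ℕ.^ suc (suc p))) ⊗ S n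
scale-v zero    S n = cong (_⊗ S n) (cong₂ _+ε_ (sym (inv-^1 n))
  (sym (trans (*-identityˡ _) (trans (inv-^-suc n 1) (cong (inv n *_) (inv-^1 n))))))
scale-v (suc p) S n = begin
  v n ⊗ scale v p (λ k → v k ⊗ S k) n  ≡⟨ cong (v n ⊗_) (scale-v p S n) ⟩
  v n ⊗ ((a +ε s * b) ⊗ S n)           ≡⟨ ⊕⊗.*-assoc (v n) (a +ε s * b) (S n) ⟨
  v n ⊗ (a +ε s * b) ⊗ S n             ≡⟨ cong (_⊗ S n) (cong₂ _+ε_ (sym (inv-^-suc n (suc p))) eq) ⟩
  (b +ε ℕ→ℚ (2 ℕ.+ p) * inv (n ℕ.^ (3 ℕ.+ p))) ⊗ S n ∎
  where
  open ≡-Reasoning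
  open +-*-Solver
  x = inv n
  s = ℕ→ℚ (suc p)
  a = inv (n ℕ.^ suc p)
  b = inv (n ℕ.^ suc (suc p))
  eq : x * (s * b) + x * x * a ≡ ℕ→ℚ (2 ℕ.+ p) * inv (n ℕ.^ (3 ℕ.+ p))
  eq = begin
    x * (s * b) + x * x * a      ≡⟨ cong (λ q → x * (s * b) + q) (trans (*-assoc x x a) (cong (x *_) (sym (inv-^-suc n (suc p))))) ⟩
    x * (s * b) + x * b          ≡⟨ solve 3 (λ x s b → x :* (s :* b) :+ x :* b := (con 1ℚ :+ s) :* (x :* b)) refl x s b ⟩
    (1ℚ + s) * (x * b)           ≡⟨ cong₂ _*_ (ℕ→ℚ-homo-+ 1 (suc p)) (inv-^-suc n (suc (suc p))) ⟨
    ℕ→ℚ (2 ℕ.+ p) * inv (n ℕ.^ (3 ℕ.+ p)) ∎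

rhs-pair : ∀ p m M → du (pair (K ᵀ) (scale v p (chain v (suc m))) δ₀ M) ≡ rhsPartial p m M
rhs-pair p m M = begin
  du (pair (K ᵀ) G δ₀ M)                 ≡⟨ cong du (pair-δ₀ (K ᵀ) G M) ⟩
  -- `K 0 n` is the empty product, so the kernel disappears from this end.
  du (∑ (suc M) (λ n → G n ⊗ 1ᴰ))        ≡⟨ cong du (∑-cong {λ n → G n ⊗ 1ᴰ} {G} (λ n → ⊕⊗.*-identityʳ (G n)) (suc M)) ⟩
  du (∑ (suc M) G)                       ≡⟨ cong du (∑-sumTo G M (scale-0 v-weight p (chain-0 v-weight m))) ⟩
  sumTo M (λ n → du (G n))               ≡⟨ sumTo-cong {λ n → du (G n)} {λ n → s * a n + b n} term M ⟩
  sumTo M (λ n → s * a n + b n)          ≡⟨ sumTo-+ (λ n → s * a n) b M ⟩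
  sumTo M (λ n → s * a n) + sumTo M b    ≡⟨ cong₂ _+_ (sumTo-*ˡ s a M) (sumTo-dz (suc p) m M) ⟩
  rhsPartial p m M ∎
  where
  open ≡-Reasoning
  open +-*-Solver
  G = scale v p (chain v (suc m))
  s = ℕ→ℚ (suc p)
  a b : ℕ → ℚ
  a n = inv (n ℕ.^ suc (suc p)) * mzvT (ones m) (n ℕ.∸ 1)
  b n = inv (n ℕ.^ suc p) * dz m (n ℕ.∸ 1)
  term : ∀ n → du (G (suc n)) ≡ s * a (suc n) + b (suc n)
  term n = begin
    du (G (suc n))                       ≡⟨ cong du (scale-v p (λ k → ∑ k (chain v m)) (suc n)) ⟩
    du ((i +ε s * j) ⊗ ∑ (suc n) (chain v m)) ≡⟨ cong (λ q → du ((i +ε s * j) ⊗ q)) (∑-chain-v m n) ⟩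
    i * dz m n + s * j * mzvT (ones m) n ≡⟨ solve 5 (λ i d s j z → i :* d :+ s :* j :* z := s :* (j :* z) :+ i :* d) refl i (dz m n) s j (mzvT (ones m) n) ⟩
    s * (j * mzvT (ones m) n) + i * dz m n ∎
    where
    i = inv (suc n ℕ.^ suc p)
    j = inv (suc n ℕ.^ suc (suc p))

-- Convergence.

re-scale-u≤ : ∀ i F n → 0≤ᴰ F n → re (scale u i F n) ≤ re (F n)
re-scale-u≤ zero    F n 0≤F = ≤-refl
re-scale-u≤ (suc i) F n 0≤F = ≤-trans (*-monoˡ (0≤inv n) (re-scale-u≤ i F n 0≤F))
  (subst (inv n * re (F n) ≤_) (*-identityˡ (re (F n))) (*-monoʳ (proj₁ 0≤F) (inv≤1 n)))

-- The series is dominated by `Λ ^ suc p` / n², with one `Λ` from H_n and p from the nested sum. The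
-- right-hand series inherits convergence through `Cauchy-SameLimit`.
lhs-cauchy : ∀ p m → Cauchy (lhsPartial (suc p) m)
lhs-cauchy p m = cauchy-sum {λ n → H n * f n} (suc p) (λ n → 0≤* (0≤H n) (0≤f n)) bound
  where
  open ≤-Reasoning
  open +-*-Solver
  f : ℕ → ℚ
  f n = ℕ→ℚ (stirling n (suc p)) * inv (n ! ℕ.* n ℕ.^ suc m)
  0≤f : ∀ n → 0ℚ ≤ f n
  0≤f n = 0≤* (0≤ℕ→ℚ (stirling n (suc p))) (0≤inv (n ! ℕ.* n ℕ.^ suc m))
  S : ℕ → ℚ
  S n = re (∑ (suc n) (chain u p))
  S≤ : ∀ n → S n ≤ Λ (suc n) ^ p
  S≤ n = ≤-trans (re≤‖‖ (0≤ᴰ-∑ (0≤chain u-weight p) (suc n))) (≤-trans (‖∑chain‖≤ u-weight p n) (Λ^-mono p (ℕ.n≤1+n n)))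
  H≤Λ : ∀ n → H n ≤ Λ n
  H≤Λ n = ≤-trans (p≤q+p {H n} {1ℚ} 0≤1) (1+H≤Λ n)
  f≤ : ∀ n → f (suc n) ≤ inv (suc n) * (inv (suc n) * Λ (suc n) ^ p)
  f≤ n = begin
    f (suc n)                                                 ≡⟨ cong re (scale-chain-u (suc m) (suc p) (suc n)) ⟨
    -- Of the m + 1 extra factors 1/n one is kept and m are bounded by 1; the second 1/n comes from
    -- the chain.
    inv (suc n) * re (scale u m (chain u (suc p)) (suc n))    ≤⟨ *-monoˡ (0≤inv (suc n)) (re-scale-u≤ m (chain u (suc p)) (suc n) (0≤chain u-weight (suc p) (suc n))) ⟩
    inv (suc n) * (inv (suc n) * S n)                         ≤⟨ *-monoˡ (0≤inv (suc n)) (*-monoˡ (0≤inv (suc n)) (S≤ n)) ⟩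
    inv (suc n) * (inv (suc n) * Λ (suc n) ^ p) ∎
  bound : ∀ n → H (suc n) * f (suc n) ≤ Λ (suc n) ^ suc p * (inv (suc n) * inv (suc n))
  bound n = begin
    H (suc n) * f (suc n)                                     ≤⟨ *-mono-≤ (0≤H (suc n)) (H≤Λ (suc n)) (0≤f (suc n)) (f≤ n) ⟩
    Λ (suc n) * (inv (suc n) * (inv (suc n) * Λ (suc n) ^ p)) ≡⟨ solve 3 (λ L x P → L :* (x :* (x :* P)) := L :* P :* (x :* x)) refl (Λ (suc n)) (inv (suc n)) (Λ (suc n) ^ p) ⟩
    Λ (suc n) ^ suc p * (inv (suc n) * inv (suc n)) ∎

theorem2p6 : (p m : ℕ) → p ≥ 1 → SeriesEq (lhsPartial p m) (rhsPartial p m)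
theorem2p6 (suc p) m (ℕ.s≤s _) = lhs-cauchy p m , Cauchy-SameLimit {lhsPartial (suc p) m} {rhsPartial (suc p) m} (lhs-cauchy p m) same , same
  where
  same : SameLimit (lhsPartial (suc p) m) (rhsPartial (suc p) m)
  same = SameLimit-≡ {λ M → du (pair K (scale u (suc m) (chain u (suc p))) δ₀ M)} {lhsPartial (suc p) m}
                     {λ M → du (pair (K ᵀ) (scale v (suc p) (chain v (suc m))) δ₀ M)} {rhsPartial (suc p) m}
                     (lhs-pair p m) (rhs-pair (suc p) m) (duality p m)
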